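{- Let $\Gamma$ be a graph with at least two vertices of degree $|V(\Gamma)|-1$. Then $\Gamma$ admits a $P_4$-decomposition if, and only if, $|E(\Gamma)|\equiv 0\pmod 3$. If $|E(\Gamma)|\equiv 1\pmod 3$ (respectively $|E(\Gamma)|\equiv 2\pmod 3$), then the edge set of $\Gamma$ can be partitioned into the edge sets of a collection of subgraphs isomorphic to $P_4$ together with one remaining edge (respectively two remaining edges, which may or may not share a vertex).
   Context: Graphs are finite and simple; $V(\Gamma)$ and $E(\Gamma)$ denote the vertex set and the edge set of $\Gamma$. $P_4$ denotes the path with $4$ vertices and $3$ edges. A $P_4$-decomposition of a graph $\Gamma$ is a set of subgraphs of $\Gamma$, each isomorphic to $P_4$, whose edge sets partition $E(\Gamma)$.
   Formalization: The formal theorem assumes that the graph does not have exactly 3 vertices; this excludes only the triangle K₃, for which the stated equivalence fails, since it has 3 edges but contains no P₄. -}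

module Defs where

open import Level using (0ℓ)
open import Data.Nat using (ℕ; suc; _∸_)
open import Data.Nat.Properties using (1+n≢n) renaming (_≟_ to _≟ℕ_)
open import Data.Fin using (Fin; toℕ; _<?_)
open import Data.Fin.Subset using (Subset; _∈_)
open import Data.List using (List; length; filter; allFin; cartesianProduct)
open import Data.Product using (∃; ∃₂; ∃!; _×_; _,_; proj₁)
open import Data.Sum using (_⊎_; [_,_]; swap)
open import Function using (_⇔_; _↔_; _∘_; Inverse)
open import Relation.Binary using (Rel; Symmetric; Irreflexive; Decidable; _⇒_)
open import Relation.Binary.PropositionalEquality using (_≡_; _≢_; refl; sym)
open import Relation.Nullary.Decidable using (_×-dec_; _⊎-dec_)

record Graph (V : Set) : Set₁ where
  field
    Adj    : Rel V 0ℓ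
    adj?   : Decidable Adj
    symm   : Symmetric Adj
    irrefl : Irreflexive _≡_ Adj

open Graph public

record _≅_ {V W : Set} (G : Graph V) (H : Graph W) : Set where
  field
    bijection : V ↔ W
    adjacency : ∀ x y → Adj G x y ⇔ Adj H (Inverse.to bijection x) (Inverse.to bijection y)

path : ∀ k → Graph (Fin k)
path k = record
  { Adj    = λ i j → toℕ j ≡ suc (toℕ i) ⊎ toℕ i ≡ suc (toℕ j)
  ; adj?   = λ i j → (toℕ j ≟ℕ suc (toℕ i)) ⊎-dec (toℕ i ≟ℕ suc (toℕ j))
  ; symm   = swap
  ; irrefl = λ { refl → [ 1+n≢n ∘ sym , 1+n≢n ∘ sym ] }
  }

P₄ : Graph (Fin 4)
P₄ = path 4

module _ {n : ℕ} (Γ : Graph (Fin n)) where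

  degree : Fin n → ℕ
  degree x = length (filter (adj? Γ x) (allFin n))

  -- Each edge {x , y} is listed once, as the pair with x < y.
  edges : List (Fin n × Fin n)
  edges = filter (λ (x , y) → (x <? y) ×-dec adj? Γ x y)
                 (cartesianProduct (allFin n) (allFin n))

  ∣E∣ : ℕ
  ∣E∣ = length edges

  AtLeastTwoUniversalVertices : Set
  AtLeastTwoUniversalVertices =
    ∃₂ λ u v → u ≢ v × degree u ≡ n ∸ 1 × degree v ≡ n ∸ 1

  record Subgraph : Set₁ where
    field
      vertices : Subset n
      graph    : Graph (∃ (_∈ vertices))
      included : ∀ {x y} → Adj graph x y → Adj Γ (proj₁ x) (proj₁ y)

-- Sets of edges are represented by symmetric relations on the vertices of Γ:
-- the edge {x , y} belongs to the set when x and y are related.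
EdgeSet : ℕ → Set₁
EdgeSet n = Rel (Fin n) 0ℓ

edgeSet : ∀ {n} {Γ : Graph (Fin n)} → Subgraph Γ → EdgeSet n
edgeSet H x y = ∃₂ λ x∈H y∈H → Adj (Subgraph.graph H) (x , x∈H) (y , y∈H)

singleEdge : ∀ {n} → Fin n × Fin n → EdgeSet n
singleEdge (a , b) x y = (x ≡ a × y ≡ b) ⊎ (x ≡ b × y ≡ a)

record PartitionsEdges {n} (Γ : Graph (Fin n)) {I : Set} (part : I → EdgeSet n) : Set where
  field
    nonempty : ∀ i → ∃₂ (part i)
    included : ∀ i → part i ⇒ Adj Γ
    unique   : ∀ {x y} → Adj Γ x y → ∃! _≡_ λ i → part i x y

-- A finite set of subgraphs is given as a family indexed by Fin k; its members
-- are distinct because their edge sets are nonempty and pairwise disjoint.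
record P₄-Decomposition {n} (Γ : Graph (Fin n)) : Set₁ where
  field
    k         : ℕ
    paths     : Fin k → Subgraph Γ
    isP₄      : ∀ i → P₄ ≅ Subgraph.graph (paths i)
    partition : PartitionsEdges Γ (edgeSet ∘ paths)

-- The r remaining edges are pairwise distinct since the parts are disjoint.
record P₄-DecompositionWithRemainder {n} (Γ : Graph (Fin n)) (r : ℕ) : Set₁ where
  field
    k         : ℕ
    paths     : Fin k → Subgraph Γ
    isP₄      : ∀ i → P₄ ≅ Subgraph.graph (paths i)
    remaining : Fin r → Fin n × Fin n
    partition : PartitionsEdges Γ {Fin k ⊎ Fin r}
                  [ edgeSet ∘ paths , singleEdge ∘ remaining ]

{-# OPTIONS --safe #-}
-- Call the two universal vertices u and v, let W be the other vertices and H the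
-- graph induced on W.  Adding the edges of H one at a time to |W| isolated points
-- and splitting off a P₄ whenever one appears, H becomes a union of P₄'s and of
-- vertex-disjoint stars and triangles covering W.  Together with its joins to u and
-- v, a triangle is a union of three P₄'s, and two leaves of a star can be removed as
-- two P₄'s, so that only isolated points and single edges matter.  These are
-- processed one after the other; besides the P₄'s already split off there is a
-- residue of at most two edges, into which the joins of the next point or edge fit.
-- The edge uv makes the first step special: uv and the joins of a single point form
-- a triangle, which is no union of P₄'s, so a second star or triangle is needed, and
-- it is missing only if Γ is K₃.

module Submission where

open import Defs
open import Level using (0ℓ)
open import Data.Nat using (ℕ; zero; suc; _+_; _*_; _∸_; _%_; _≤_; z≤n; s≤s)
open import Data.Nat.Properties using (_≤?_; m≤m+n; 1+n≰n; +-comm)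
open import Data.Nat.DivMod using ([m+kn]%n≡m%n; m<n⇒m%n≡m)
open import Data.Fin using (Fin; zero; suc; _<_; _<?_)
open import Data.Fin.Patterns
open import Data.Fin.Properties using (_≟_; <-cmp; <-asym)
open import Data.List using
  (List; []; _∷_; _++_; map; length; lookup; concatMap; filter; allFin; cartesianProduct)
open import Data.List.Properties using
  (map-++; map-concatMap; concatMap-map; concatMap-cong; concatMap-pure; concatMap-++;
   length-++; length-tabulate; ++-identityʳ; ++-assoc; ++-conicalʳ)
open import Data.List.Relation.Unary.All as All using (All; []; _∷_)
import Data.List.Relation.Unary.All.Properties as All
open import Data.List.Relation.Unary.Any as Any using (here; there)
import Data.List.Relation.Unary.Any.Properties as Any
open import Data.List.Relation.Unary.AllPairs as AllPairs using (AllPairs; []; _∷_)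
import Data.List.Relation.Unary.AllPairs.Properties as AllPairs
open import Data.List.Relation.Unary.Unique.Propositional using (Unique)
import Data.List.Relation.Unary.Unique.Propositional.Properties as Unique
import Data.List.Relation.Unary.Unique.DecPropositional as UniqueDec
import Data.List.Relation.Unary.Unique.Setoid as UniqueSetoid
import Data.List.Membership.DecPropositional as DecMembership
import Data.List.Membership.Setoid as MembershipSetoid
import Data.List.Membership.Setoid.Properties as MembershipSetoidProperties
open import Data.List.Membership.Propositional using (_∈_; find; lose)
open import Data.List.Membership.Propositional.Properties using
  (∈-lookup; ∈-++⁺ˡ; ∈-++⁺ʳ; ∈-++⁻; ∈-map⁺; ∈-∃++; ∈-filter⁺; ∈-filter⁻; ∈-cartesianProduct⁺; ∈-allFin)
open import Data.List.Relation.Binary.Sublist.Propositional using (_⊆_; []; _∷_; _∷ʳ_; ⊆-refl)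
open import Data.List.Relation.Binary.Sublist.Propositional.Properties using (All-resp-⊆)
import Data.List.Relation.Binary.Permutation.Setoid as SetoidPermutation
import Data.List.Relation.Binary.Permutation.Setoid.Properties as SetoidPermutationProperties
import Data.Fin.Subset as Subset
import Data.Fin.Subset.Properties as Subset
open import Data.Fin.Subset using (Subset)
open import Data.Vec.Properties.WithK using ([]=-irrelevant)
open import Data.Maybe using (Maybe; just; nothing; is-just; to-witness-T; _>>=_)
open import Data.Bool using (T)
open import Data.List.Relation.Binary.Pointwise using (Pointwise-≡⇒≡)
open import Data.Product using (∃; ∃₂; ∃!; _×_; _,_; proj₁; proj₂)
open import Data.Sum using (_⊎_; inj₁; inj₂; [_,_])
open import Data.Sum.Properties using (inj₁-injective)
open import Data.Empty using (⊥; ⊥-elim)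
open import Data.Vec as Vec using (Vec; []; _∷_; toList)
import Data.Vec.Properties as Vec
open import Function using (_∘_; _⇔_; case_of_; id; mk⇔; mk↔ₛ′; Injection; Inverse; Equivalence)
open import Function.Properties.Inverse using (Inverse⇒Injection)
open import Relation.Binary using (tri<; tri≈; tri>; Setoid; DecSetoid)
open import Relation.Binary.PropositionalEquality as ≡ using (_≡_; _≢_; refl; cong; cong₂; subst; subst₂)
import Relation.Binary.PropositionalEquality.Properties as ≡
open import Relation.Nullary using (Dec; yes; no; ¬_; ¬?; contradiction; _×-dec_; _⊎-dec_)
open import Relation.Nullary.Decidable using (True; toWitness)

-- Edges up to orientation, and matching of closed lists.

private variable
  n k : ℕ

Edge : ℕ → Set
Edge n = Fin n × Fin n

-- With `singleEdge` as equality, permutations over this setoid compare edge lists up to order and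
-- orientation at once. The arguments are arranged so that membership of `(x , y)` in a list unfolds
-- to `singleEdge e x y` for some entry `e`.
edgeDecSetoid : ℕ → DecSetoid 0ℓ 0ℓ
edgeDecSetoid n = record
  { Carrier = Edge n
  ; _≈_ = λ (x , y) e → singleEdge e x y
  ; isDecEquivalence = record
    { isEquivalence = record
      { refl = inj₁ (refl , refl)
      ; sym = λ { (inj₁ (refl , refl)) → inj₁ (refl , refl) ; (inj₂ (refl , refl)) → inj₂ (refl , refl) }
      ; trans = λ { (inj₁ (refl , refl)) q → q
                  ; (inj₂ (refl , refl)) (inj₁ (refl , refl)) → inj₂ (refl , refl)
                  ; (inj₂ (refl , refl)) (inj₂ (refl , refl)) → inj₁ (refl , refl) }
      }
    ; _≟_ = λ (x , y) (a , b) → (x ≟ a ×-dec y ≟ b) ⊎-dec (x ≟ b ×-dec y ≟ a)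
    }
  }

edgeSetoid : ℕ → Setoid 0ℓ 0ℓ
edgeSetoid n = DecSetoid.setoid (edgeDecSetoid n)

-- A semi-decision procedure: it is only run on closed lists, where its success is
-- checked by evaluation.
module Matching {a ℓ} (S : DecSetoid a ℓ) where

  open DecSetoid S using (setoid) renaming (Carrier to A; _≟_ to _≟ₛ_; refl to ≈-refl)
  open SetoidPermutation setoid

  extract : ∀ (x : A) ys → Maybe (∃ λ zs → x ∷ zs ↭ ys)
  extract x []       = nothing
  extract x (y ∷ ys) with x ≟ₛ y
  ... | yes x≈y = just (ys , prep x≈y ↭-refl)
  ... | no  _   = extract x ys >>= λ (zs , p) → just (y ∷ zs , trans (↭-swap x y ↭-refl) (↭-prep y p))

  match : ∀ (xs ys : List A) → Maybe (xs ↭ ys)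
  match []       []      = just ↭-refl
  match []       (_ ∷ _) = nothing
  match (x ∷ xs) ys      = extract x ys >>= λ (zs , p) →
                           match xs zs  >>= λ q → just (trans (↭-prep x q) p)

-- Lists without repetition

AllPairs-++⁻ : ∀ {a ℓ} {A : Set a} {R : A → A → Set ℓ} xs {ys} → AllPairs R (xs ++ ys) →
               AllPairs R xs × AllPairs R ys × All (λ x → All (R x) ys) xs
AllPairs-++⁻ []       ys!        = [] , ys! , []
AllPairs-++⁻ (x ∷ xs) (x∉ ∷ xs++ys!) =
  let xs! , ys! , xs#ys = AllPairs-++⁻ xs xs++ys!
  in All.++⁻ˡ xs x∉ ∷ xs! , ys! , All.++⁻ʳ xs x∉ ∷ xs#ys

module UniqueLists {a ℓ} (S : Setoid a ℓ) where

  open Setoid S using (_≈_) renaming (Carrier to A; sym to ≈-sym; trans to ≈-trans; refl to ≈-refl)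
  open MembershipSetoid S using () renaming (_∈_ to _∈ₛ_)
  open SetoidPermutation S renaming (_↭_ to _↭ₛ_)
  open SetoidPermutationProperties S using (∈-resp-↭; Unique-resp-↭; xs↭ys⇒|xs|≡|ys|) renaming (++-identityʳ to ↭-++-identityʳ)
  open UniqueSetoid S renaming (Unique to Uniqueₛ)

  pull : ∀ {x ys} → x ∈ₛ ys → ∃ λ zs → ys ↭ₛ x ∷ zs
  pull {ys = y ∷ ys} (here x≈y)   = ys , prep (≈-sym x≈y) (↭-refl {x = ys})
  pull {ys = y ∷ ys} (there x∈ys) =
    let zs , p = pull x∈ys in y ∷ zs , trans (↭-prep y p) (↭-swap y _ ↭-refl)

  -- The elements of `xs` are pulled out of `ys` one by one; a later one is still found in what is
  -- left because it differs from those already pulled out.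
  complete : ∀ {xs ys} → Uniqueₛ xs → (∀ {x} → x ∈ₛ xs → x ∈ₛ ys) → ∃ λ zs → ys ↭ₛ xs ++ zs
  complete {[]}     {ys} _          _     = ys , ↭-refl
  complete {x ∷ xs} {ys} (x∉ ∷ xs!) xs⊆ys =
    let ys′ , p = pull (xs⊆ys (here ≈-refl))
        zs  , q = complete xs! λ z∈xs → case ∈-resp-↭ p (xs⊆ys (there z∈xs)) of λ
          { (here z≈x)    → contradiction z∈xs (All.All¬⇒¬Any (All.map (λ x≉y z≈y → x≉y (≈-trans (≈-sym z≈x) z≈y)) x∉))
          ; (there z∈ys′) → z∈ys′ }
    in zs , trans p (↭-prep x q)

  ⊆⇒length≤ : ∀ {xs ys} → Uniqueₛ xs → (∀ {x} → x ∈ₛ xs → x ∈ₛ ys) → length xs ≤ length ys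
  ⊆⇒length≤ {xs} xs! xs⊆ys =
    let zs , p = complete xs! xs⊆ys
    in subst (length xs ≤_) (≡.sym (≡.trans (xs↭ys⇒|xs|≡|ys| p) (length-++ xs))) (m≤m+n _ _)

  sameElements⇒↭ : ∀ {xs ys} → Uniqueₛ xs → Uniqueₛ ys →
                   (∀ {x} → x ∈ₛ xs → x ∈ₛ ys) → (∀ {x} → x ∈ₛ ys → x ∈ₛ xs) → ys ↭ₛ xs
  sameElements⇒↭ {xs} {ys} xs! ys! xs⊆ys ys⊆xs with complete xs! xs⊆ys
  ... | []     , p = trans p (↭-++-identityʳ xs)
  -- A leftover `z` belongs to `ys`, hence to `xs`, so `ys` would contain it twice.
  ... | z ∷ zs , p =
    let _ , _ , xs#zs = AllPairs-++⁻ xs (Unique-resp-↭ p ys!)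
    in contradiction (ys⊆xs (∈-resp-↭ (↭-sym p) (∈-++⁺ʳ′ (here ≈-refl))))
         (All.All¬⇒¬Any (All.map (λ { (x≉z ∷ _) → x≉z ∘ ≈-sym }) xs#zs))
    where ∈-++⁺ʳ′ = MembershipSetoidProperties.∈-++⁺ʳ S xs

module _ {n : ℕ} where
  open MembershipSetoid (edgeSetoid n) public using () renaming (_∈_ to _∈ₑ_)
  open DecMembership (_≟_ {n}) public using (_∈?_)
  open UniqueSetoid (edgeSetoid n) public using () renaming (Unique to Uniqueₑ)
  open SetoidPermutation (edgeSetoid n) public
    using (_↭_; ↭-refl; ↭-sym; ↭-trans; ↭-prep; ↭-reflexive; module PermutationReasoning)
  open SetoidPermutationProperties (edgeSetoid n) public
    using (++⁺; shifts)
    renaming (++⁺ˡ to ↭-++⁺ˡ; ++⁺ʳ to ↭-++⁺ʳ; Unique-resp-↭ to Uniqueₑ-resp-↭;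
              ∈-resp-↭ to ∈ₑ-resp-↭; xs↭ys⇒|xs|≡|ys| to ↭-length)
  open SetoidPermutation (≡.setoid (Fin n)) public
    using ()
    renaming (_↭_ to _↭ᵛ_; ↭-refl to ↭ᵛ-refl; ↭-sym to ↭ᵛ-sym; ↭-trans to ↭ᵛ-trans; ↭-prep to ↭ᵛ-prep)
  open SetoidPermutationProperties (≡.setoid (Fin n)) public
    using ()
    renaming (shifts to ↭ᵛ-shifts; ↭-shift to ↭ᵛ-shift; ++⁺ˡ to ++⁺ˡᵛ; ++⁺ʳ to ++⁺ʳᵛ;
              Unique-resp-↭ to Unique-resp-↭ᵛ; ∈-resp-↭ to ∈-resp-↭ᵛ; xs↭ys⇒|xs|≡|ys| to ↭ᵛ-length)

regroup : ∀ (A X B Y : List (Edge n)) → (A ++ X) ++ (B ++ Y) ↭ (A ++ B) ++ (X ++ Y)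
regroup A X B Y = begin
  (A ++ X) ++ (B ++ Y) ≡⟨ ++-assoc A X (B ++ Y) ⟩
  A ++ X ++ B ++ Y     ↭⟨ ↭-++⁺ˡ A (shifts X B) ⟩
  A ++ B ++ X ++ Y     ≡⟨ ++-assoc A B (X ++ Y) ⟨
  (A ++ B) ++ (X ++ Y) ∎
  where open PermutationReasoning

-- Paths and carving

Path : ℕ → Set
Path n = Vec (Fin n) 4

pathEdges : Path n → List (Edge n)
pathEdges (a ∷ b ∷ c ∷ d ∷ []) = (a , b) ∷ (b , c) ∷ (c , d) ∷ []

Distinct : Path n → Set
Distinct p = Unique (toList p)

-- Paths have three edges, so the bound 2 forces the number of remaining edges to be the length of
-- `L` modulo 3. One construction thus serves all three residue classes.
record NearDecomposition (L : List (Edge n)) : Set where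
  constructor near
  field
    {paths}     : List (Path n)
    {remaining} : List (Edge n)
    distinct    : All Distinct paths
    short       : length remaining ≤ 2
    splits      : L ↭ concatMap pathEdges paths ++ remaining

stop : ∀ L → {True (length L ≤? 2)} → NearDecomposition {n} L
stop L {short} = near [] (toWitness short) ↭-refl

respects : ∀ {L L′ : List (Edge n)} → L ↭ L′ → NearDecomposition L′ → NearDecomposition L
respects L↭L′ (near d s p) = near d s (↭-trans L↭L′ p)

addPaths : ∀ {ps} {L : List (Edge n)} → All Distinct ps →
           NearDecomposition L → NearDecomposition (concatMap pathEdges ps ++ L)
addPaths {ps = ps} {L} ds (near {qs} {rs} d s p) = near (All.++⁺ ds d) s (begin
  concatMap pathEdges ps ++ L                                ↭⟨ ↭-++⁺ˡ (concatMap pathEdges ps) p ⟩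
  concatMap pathEdges ps ++ (concatMap pathEdges qs ++ rs)   ≡⟨ ++-assoc (concatMap pathEdges ps) _ rs ⟨
  (concatMap pathEdges ps ++ concatMap pathEdges qs) ++ rs   ≡⟨ cong (_++ rs) (concatMap-++ pathEdges ps qs) ⟨
  concatMap pathEdges (ps ++ qs) ++ rs                       ∎)
  where open PermutationReasoning

lookup-injective : ∀ {A : Set} {xs : List A} → Unique xs → ∀ {i j} → lookup xs i ≡ lookup xs j → i ≡ j
lookup-injective (_ ∷ _)  {zero}  {zero}  _  = refl
lookup-injective (p ∷ _)  {zero}  {suc j} eq = contradiction eq (All.lookup p (∈-lookup j))
lookup-injective (p ∷ _)  {suc i} {zero}  eq = contradiction (≡.sym eq) (All.lookup p (∈-lookup i))
lookup-injective (_ ∷ ps) {suc i} {suc j} eq = cong suc (lookup-injective ps eq)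

mapEdge : (Fin k → Fin n) → Edge k → Edge n
mapEdge σ (i , j) = σ i , σ j

map-pathEdges : ∀ (σ : Fin k → Fin n) ps →
                map (mapEdge σ) (concatMap pathEdges ps) ≡ concatMap pathEdges (map (Vec.map σ) ps)
map-pathEdges σ ps = begin
  map (mapEdge σ) (concatMap pathEdges ps)    ≡⟨ map-concatMap (mapEdge σ) pathEdges ps ⟩
  concatMap (map (mapEdge σ) ∘ pathEdges) ps  ≡⟨ concatMap-cong (λ { (a ∷ b ∷ c ∷ d ∷ []) → refl }) ps ⟩
  concatMap (pathEdges ∘ Vec.map σ) ps        ≡⟨ concatMap-map pathEdges (Vec.map σ) ps ⟨
  concatMap pathEdges (map (Vec.map σ) ps)    ∎
  where open ≡.≡-Reasoning

map-↭ : ∀ (σ : Fin k → Fin n) {L L′} → L ↭ L′ → map (mapEdge σ) L ↭ map (mapEdge σ) L′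
map-↭ σ = SetoidPermutationProperties.map⁺ (edgeSetoid _) (edgeSetoid _)
  λ { (inj₁ (refl , refl)) → inj₁ (refl , refl) ; (inj₂ (refl , refl)) → inj₂ (refl , refl) }

distinct? : ∀ (p : Path k) → Dec (Distinct p)
distinct? p = UniqueDec.unique? _≟_ (toList p)

map-distinct : ∀ {σ : Fin k → Fin n} → (∀ {i j} → σ i ≡ σ j → i ≡ j) →
               ∀ {ps} → All Distinct ps → All Distinct (map (Vec.map σ) ps)
map-distinct {σ = σ} inj = All.map⁺ ∘ All.map λ {p} →
  subst Unique (≡.sym (Vec.toList-map σ p)) ∘ Unique.map⁺ inj

module _ (vs : List (Fin n)) where

  private
    k′ = length vs
    ⟦_⟧ : List (Edge k′) → List (Edge n)
    ⟦_⟧ = map (mapEdge (lookup vs))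

  -- A, B, A′, B′ and ps are closed lists over the indices of vs, so that the identity
  -- of edge multisets is found by evaluation; X and Y are the parts of the lists of
  -- joins and of piece edges that the step does not touch.
  carve-↭ : ∀ ps (A B A′ B′ : List (Edge k′)) →
            {T (is-just (Matching.match (edgeDecSetoid k′) (A ++ B) (concatMap pathEdges ps ++ A′ ++ B′)))} →
            ∀ S X Y → S ++ (⟦ A ⟧ ++ X) ++ (⟦ B ⟧ ++ Y)
                    ↭ concatMap pathEdges (map (Vec.map (lookup vs)) ps) ++ S ++ (⟦ A′ ⟧ ++ X) ++ (⟦ B′ ⟧ ++ Y)
  carve-↭ ps A B A′ B′ {ok} S X Y = begin
    S ++ (⟦ A ⟧ ++ X) ++ (⟦ B ⟧ ++ Y)      ↭⟨ ↭-++⁺ˡ S (regroup ⟦ A ⟧ X ⟦ B ⟧ Y) ⟩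
    S ++ (⟦ A ⟧ ++ ⟦ B ⟧) ++ X ++ Y        ≡⟨ cong (λ E → S ++ E ++ X ++ Y) (map-++ f A B) ⟨
    S ++ ⟦ A ++ B ⟧ ++ X ++ Y              ↭⟨ ↭-++⁺ˡ S (↭-++⁺ʳ (X ++ Y) (map-↭ _ (to-witness-T _ ok))) ⟩
    S ++ ⟦ P ++ A′ ++ B′ ⟧ ++ X ++ Y       ≡⟨ cong (λ E → S ++ E ++ X ++ Y) (map-++ f P (A′ ++ B′)) ⟩
    S ++ (⟦ P ⟧ ++ ⟦ A′ ++ B′ ⟧) ++ X ++ Y ≡⟨ cong₂ (λ P′ E → S ++ (P′ ++ E) ++ X ++ Y) (map-pathEdges _ ps) (map-++ f A′ B′) ⟩
    S ++ (Q ++ ⟦ A′ ⟧ ++ ⟦ B′ ⟧) ++ X ++ Y ≡⟨ cong (S ++_) (++-assoc Q _ _) ⟩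
    S ++ Q ++ (⟦ A′ ⟧ ++ ⟦ B′ ⟧) ++ X ++ Y ↭⟨ shifts S Q ⟩
    Q ++ S ++ (⟦ A′ ⟧ ++ ⟦ B′ ⟧) ++ X ++ Y ↭⟨ ↭-++⁺ˡ Q (↭-++⁺ˡ S (regroup ⟦ A′ ⟧ X ⟦ B′ ⟧ Y)) ⟨
    Q ++ S ++ (⟦ A′ ⟧ ++ X) ++ (⟦ B′ ⟧ ++ Y) ∎
    where
    open PermutationReasoning
    f = mapEdge (lookup vs)
    P = concatMap pathEdges ps
    Q = concatMap pathEdges (map (Vec.map (lookup vs)) ps)

  -- The paths are distinct over the indices by evaluation, and remain so in the graph because
  -- `lookup vs` is injective. With `ps` empty, edges are only reordered and reversed, which brings
  -- a residue into its prescribed form.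
  carve : Unique vs → ∀ ps (A B A′ B′ : List (Edge k′)) →
          {T (is-just (Matching.match (edgeDecSetoid k′) (A ++ B) (concatMap pathEdges ps ++ A′ ++ B′)))} →
          {True (All.all? distinct? ps)} →
          ∀ S X Y → NearDecomposition (S ++ (⟦ A′ ⟧ ++ X) ++ (⟦ B′ ⟧ ++ Y)) →
          NearDecomposition (S ++ (⟦ A ⟧ ++ X) ++ (⟦ B ⟧ ++ Y))
  carve vs! ps A B A′ B′ {ok} {ds} S X Y =
    respects (carve-↭ ps A B A′ B′ {ok} S X Y) ∘
    addPaths (map-distinct (lookup-injective vs!) (toWitness ds))

-- A new residue needs distinctness of some of the vertices `vs`, in another order, together with
-- the untouched `W`. Choosing them by index leaves only a closed list to be checked.
pick : ∀ {A : Set} (vs : List A) {W} → Unique (vs ++ W) → ∀ is → {True (UniqueDec.unique? _≟_ is)} →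
       Unique (map (lookup vs) is ++ W)
pick vs vs++W! is {is!} =
  let vs! , W! , vs#W = AllPairs-++⁻ vs vs++W!
  in AllPairs.++⁺ (Unique.map⁺ (lookup-injective vs!) (toWitness is!)) W!
       (All.map⁺ (All.universal (λ i → All.lookup vs#W (∈-lookup i)) is))

Unique-⊆ : ∀ {A : Set} {xs ys : List A} → xs ⊆ ys → Unique ys → Unique xs
Unique-⊆ []         []         = []
Unique-⊆ (_    ∷ʳ p) (_ ∷ ys!)  = Unique-⊆ p ys!
Unique-⊆ (refl ∷  p) (y∉ ∷ ys!) = All-resp-⊆ p y∉ ∷ Unique-⊆ p ys!

unique-prefix : ∀ {A : Set} (xs : List A) {ys} → Unique (xs ++ ys) → Unique xs
unique-prefix xs = proj₁ ∘ AllPairs-++⁻ xs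

-- Stars, triangles and the residue

-- Stars and triangles are the connected graphs that contain no P₄ as a subgraph: a star without
-- leaves is a point, a star with one leaf a single edge.
data Piece (n : ℕ) : Set where
  star     : Fin n → List (Fin n) → Piece n
  triangle : Fin n → Fin n → Fin n → Piece n

pieceVertices : Piece n → List (Fin n)
pieceVertices (star c ls)      = c ∷ ls
pieceVertices (triangle a b c) = a ∷ b ∷ c ∷ []

pieceEdges : Piece n → List (Edge n)
pieceEdges (star c ls)      = map (c ,_) ls
pieceEdges (triangle a b c) = (a , b) ∷ (b , c) ∷ (a , c) ∷ []

vertices : List (Piece n) → List (Fin n)
vertices = concatMap pieceVertices

pieceEdgesOf : List (Piece n) → List (Edge n)
pieceEdgesOf = concatMap pieceEdges

module _ {n : ℕ} (u v : Fin n) where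

  joins : List (Fin n) → List (Edge n)
  joins = concatMap λ w → (u , w) ∷ (v , w) ∷ []

  Decomposes : List (Edge n) → List (Piece n) → Set
  Decomposes S C = NearDecomposition (S ++ joins (vertices C) ++ pieceEdgesOf C)

  -- Residue S W: S may be left over while the vertices of W are still to be processed.
  -- In two, the residue is a path a-x-u, where a and x may be v or already used.
  data Residue : List (Edge n) → List (Fin n) → Set where
    none : ∀ {W} → Unique (u ∷ v ∷ W) → Residue [] W
    one  : ∀ {W x} → Unique (u ∷ v ∷ x ∷ W) → Residue ((v , x) ∷ []) W
    two  : ∀ {W a x} → Unique (a ∷ x ∷ u ∷ W) → Unique (u ∷ v ∷ W) → Residue ((a , x) ∷ (x , u) ∷ []) W

  residue-unique : ∀ {S W} → Residue S W → Unique (u ∷ v ∷ W)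
  residue-unique (none W!)  = W!
  residue-unique (one W!)   = Unique-⊆ (refl ∷ refl ∷ _ ∷ʳ ⊆-refl) W!
  residue-unique (two _ W!) = W!

  shrink : ∀ {S W W′} → W′ ⊆ W → Residue S W → Residue S W′
  shrink W′⊆W (none W!)     = none (Unique-⊆ (refl ∷ refl ∷ W′⊆W) W!)
  shrink W′⊆W (one W!)      = one (Unique-⊆ (refl ∷ refl ∷ refl ∷ W′⊆W) W!)
  shrink W′⊆W (two aW! W!)  = two (Unique-⊆ (refl ∷ refl ∷ refl ∷ W′⊆W) aW!) (Unique-⊆ (refl ∷ refl ∷ W′⊆W) W!)

  -- The nine edges form the paths `a`-`b`-`c`-`u`, `u`-`a`-`c`-`v` and `a`-`v`-`b`-`u`. Since they
  -- fit exactly, any `S` is left as it was.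
  removeTriangle : ∀ S a b c C → Unique (u ∷ v ∷ a ∷ b ∷ c ∷ []) →
                   Decomposes S C → Decomposes S (triangle a b c ∷ C)
  removeTriangle S a b c C vs! = carve (u ∷ v ∷ a ∷ b ∷ c ∷ []) vs!
    ((2F ∷ 3F ∷ 4F ∷ 0F ∷ []) ∷ (0F ∷ 2F ∷ 4F ∷ 1F ∷ []) ∷ (2F ∷ 1F ∷ 3F ∷ 0F ∷ []) ∷ [])
    ((0F , 2F) ∷ (1F , 2F) ∷ (0F , 3F) ∷ (1F , 3F) ∷ (0F , 4F) ∷ (1F , 4F) ∷ [])
    ((2F , 3F) ∷ (3F , 4F) ∷ (2F , 4F) ∷ [])
    [] [] _ _ _

  -- The paths `l`-`c`-`m`-`u` and `u`-`l`-`v`-`m` use the two star edges and all joins of the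
  -- leaves; the joins of `c` stay with the smaller star.
  removeLeaves : ∀ S c l m ls C → Unique (u ∷ v ∷ c ∷ l ∷ m ∷ []) →
                 Decomposes S (star c ls ∷ C) → Decomposes S (star c (l ∷ m ∷ ls) ∷ C)
  removeLeaves S c l m ls C vs! = carve (u ∷ v ∷ c ∷ l ∷ m ∷ []) vs!
    ((3F ∷ 2F ∷ 4F ∷ 0F ∷ []) ∷ (0F ∷ 3F ∷ 1F ∷ 4F ∷ []) ∷ [])
    ((0F , 2F) ∷ (1F , 2F) ∷ (0F , 3F) ∷ (1F , 3F) ∷ (0F , 4F) ∷ (1F , 4F) ∷ [])
    ((2F , 3F) ∷ (2F , 4F) ∷ [])
    ((0F , 2F) ∷ (1F , 2F) ∷ [])
    [] _ _ _

  -- The residue is quantified here because each step hands a different one to the pieces that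
  -- follow.
  Finishes : List (Piece n) → Set
  Finishes C = ∀ {S} → Residue S (vertices C) → Decomposes S C

  -- A point contributes two edges, so the size of the residue passes from 0 to 2, from 1 to 0 and
  -- from 2 to 1. The last two cases complete the residue to a path ending in the new point or
  -- passing through it.
  finishPoint : ∀ x C → Finishes C → Finishes (star x [] ∷ C)
  finishPoint x C fin (none W!) = carve (u ∷ v ∷ x ∷ []) (unique-prefix (u ∷ v ∷ x ∷ []) W!)
    []
    ((0F , 2F) ∷ (1F , 2F) ∷ []) []
    ((1F , 2F) ∷ (2F , 0F) ∷ []) [] [] (joins (vertices C)) (pieceEdgesOf C)
    (fin (two (pick (u ∷ v ∷ x ∷ []) W! (1F ∷ 2F ∷ 0F ∷ [])) (pick (u ∷ v ∷ x ∷ []) W! (0F ∷ 1F ∷ []))))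
  finishPoint x C fin (one {x = y} W!) = carve (u ∷ v ∷ y ∷ x ∷ []) (unique-prefix (u ∷ v ∷ y ∷ x ∷ []) W!)
    ((2F ∷ 1F ∷ 3F ∷ 0F ∷ []) ∷ [])
    ((1F , 2F) ∷ (0F , 3F) ∷ (1F , 3F) ∷ []) []
    [] [] [] (joins (vertices C)) (pieceEdgesOf C)
    (fin (none (pick (u ∷ v ∷ y ∷ x ∷ []) W! (0F ∷ 1F ∷ []))))
  finishPoint z C fin (two {a = a} {x} aW! W!) = carve (a ∷ x ∷ u ∷ z ∷ []) (unique-prefix (a ∷ x ∷ u ∷ z ∷ []) aW!)
    ((0F ∷ 1F ∷ 2F ∷ 3F ∷ []) ∷ [])
    ((0F , 1F) ∷ (1F , 2F) ∷ (2F , 3F) ∷ []) []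
    [] [] [] ((v , z) ∷ joins (vertices C)) (pieceEdgesOf C)
    (fin (one W!))

  -- An edge with its joins contributes five edges, so modulo 3 the residue changes just as for a
  -- point.
  finishEdge : ∀ c l C → Finishes C → Finishes (star c (l ∷ []) ∷ C)
  finishEdge c l C fin (none W!) = carve vs (unique-prefix vs W!)
    ((0F ∷ 2F ∷ 1F ∷ 3F ∷ []) ∷ [])
    ((0F , 2F) ∷ (1F , 2F) ∷ (0F , 3F) ∷ (1F , 3F) ∷ []) ((2F , 3F) ∷ [])
    ((2F , 3F) ∷ (3F , 0F) ∷ []) [] [] (joins (vertices C)) (pieceEdgesOf C)
    (fin (two (pick vs W! (2F ∷ 3F ∷ 0F ∷ [])) (pick vs W! (0F ∷ 1F ∷ []))))
    where vs = u ∷ v ∷ c ∷ l ∷ []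
  finishEdge c l C fin (one {x = x} W!) = carve vs (unique-prefix vs W!)
    ((2F ∷ 1F ∷ 3F ∷ 4F ∷ []) ∷ (3F ∷ 0F ∷ 4F ∷ 1F ∷ []) ∷ [])
    ((1F , 2F) ∷ (0F , 3F) ∷ (1F , 3F) ∷ (0F , 4F) ∷ (1F , 4F) ∷ []) ((3F , 4F) ∷ [])
    [] [] [] (joins (vertices C)) (pieceEdgesOf C)
    (fin (none (pick vs W! (0F ∷ 1F ∷ []))))
    where vs = u ∷ v ∷ x ∷ c ∷ l ∷ []
  -- The residue is completed to `a`-`x`-`u`-`c` in a carving of its own: `a` or `x` may be `v`, so
  -- they cannot share a list of distinct vertices with `v`. The second path is `u`-`l`-`c`-`v`, and
  -- the edge `vl` remains.
  finishEdge c l C fin (two {a = a} {x} aW! W!) = carve (a ∷ x ∷ u ∷ c ∷ []) (unique-prefix (a ∷ x ∷ u ∷ c ∷ []) aW!)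
    ((0F ∷ 1F ∷ 2F ∷ 3F ∷ []) ∷ [])
    ((0F , 1F) ∷ (1F , 2F) ∷ (2F , 3F) ∷ []) []
    [] [] [] ((v , c) ∷ joins (l ∷ vertices C)) ((c , l) ∷ pieceEdgesOf C)
    (carve vs (unique-prefix vs W!)
      ((0F ∷ 3F ∷ 2F ∷ 1F ∷ []) ∷ [])
      ((1F , 2F) ∷ (0F , 3F) ∷ (1F , 3F) ∷ []) ((2F , 3F) ∷ [])
      ((1F , 3F) ∷ []) [] [] (joins (vertices C)) (pieceEdgesOf C)
      (fin (one (pick vs W! (0F ∷ 1F ∷ 3F ∷ [])))))
    where vs = u ∷ v ∷ c ∷ l ∷ []

  mutual
    finish : ∀ C → Finishes C
    finish []                   (none _)  = stop []
    finish []                   (one _)   = stop (_ ∷ [])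
    finish []                   (two _ _) = stop (_ ∷ _ ∷ [])
    finish (triangle a b c ∷ C) r =
      removeTriangle _ a b c C (unique-prefix (u ∷ v ∷ a ∷ b ∷ c ∷ []) (residue-unique r))
        (finish C (shrink (_ ∷ʳ _ ∷ʳ _ ∷ʳ ⊆-refl) r))
    finish (star c ls ∷ C)      = finishStar c ls C

    finishStar : ∀ c ls C → Finishes (star c ls ∷ C)
    finishStar c []           C   = finishPoint c C (finish C)
    finishStar c (l ∷ [])     C   = finishEdge c l C (finish C)
    finishStar c (l ∷ m ∷ ls) C r =
      removeLeaves _ c l m ls C (unique-prefix (u ∷ v ∷ c ∷ l ∷ m ∷ []) (residue-unique r))
        (finishStar c ls C (shrink (refl ∷ _ ∷ʳ _ ∷ʳ ⊆-refl) r))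

-- The first step, which has to accommodate the edge uv.

module _ {n : ℕ} (u v : Fin n) where

  joins-↭ : ∀ {W W′} → W ↭ᵛ W′ → joins u v W ↭ joins u v W′
  joins-↭ (SetoidPermutation.refl eq) = ↭-reflexive (cong (joins u v) (Pointwise-≡⇒≡ eq))
  joins-↭ (SetoidPermutation.prep refl p) = ↭-prep _ (↭-prep _ (joins-↭ p))
  joins-↭ (SetoidPermutation.swap {x = x} {y} refl refl p) = ↭-trans
    (shifts ((u , x) ∷ (v , x) ∷ []) ((u , y) ∷ (v , y) ∷ []))
    (↭-++⁺ˡ ((u , y) ∷ (v , y) ∷ (u , x) ∷ (v , x) ∷ []) (joins-↭ p))
  joins-↭ (SetoidPermutation.trans p q) = ↭-trans (joins-↭ p) (joins-↭ q)

  postpone : ∀ S p q C → Decomposes u v S (q ∷ p ∷ C) → Decomposes u v S (p ∷ q ∷ C)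
  postpone S p q C = respects (↭-++⁺ˡ S (++⁺
    (joins-↭ (↭ᵛ-shifts (pieceVertices p) (pieceVertices q)))
    (shifts (pieceEdges p) (pieceEdges q))))

  -- The residue left here is the path x-v-u, which uses up the edge uv.
  startPoint : ∀ x y ls C → Unique (u ∷ v ∷ x ∷ y ∷ ls ++ vertices C) →
               Decomposes u v ((u , v) ∷ []) (star x [] ∷ star y ls ∷ C)
  startPoint x y [] C W! = carve vs (unique-prefix vs W!)
    ((2F ∷ 0F ∷ 3F ∷ 1F ∷ []) ∷ [])
    ((0F , 1F) ∷ (0F , 2F) ∷ (1F , 2F) ∷ (0F , 3F) ∷ (1F , 3F) ∷ []) []
    ((2F , 1F) ∷ (1F , 0F) ∷ []) [] [] (joins u v (vertices C)) (pieceEdgesOf C)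
    (finish u v C (two (pick vs W! (2F ∷ 1F ∷ 0F ∷ [])) (pick vs W! (0F ∷ 1F ∷ []))))
    where vs = u ∷ v ∷ x ∷ y ∷ []
  startPoint x y (l ∷ []) C W! = carve vs (unique-prefix vs W!)
    ((2F ∷ 0F ∷ 3F ∷ 4F ∷ []) ∷ (3F ∷ 1F ∷ 4F ∷ 0F ∷ []) ∷ [])
    ((0F , 1F) ∷ (0F , 2F) ∷ (1F , 2F) ∷ (0F , 3F) ∷ (1F , 3F) ∷ (0F , 4F) ∷ (1F , 4F) ∷ []) ((3F , 4F) ∷ [])
    ((2F , 1F) ∷ (1F , 0F) ∷ []) [] [] (joins u v (vertices C)) (pieceEdgesOf C)
    (finish u v C (two (pick vs W! (2F ∷ 1F ∷ 0F ∷ [])) (pick vs W! (0F ∷ 1F ∷ []))))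
    where vs = u ∷ v ∷ x ∷ y ∷ l ∷ []
  -- As `star x []` has no edges, its two joins can be counted into the untouched list `S`; the two
  -- readings agree by computation.
  startPoint x y (l ∷ m ∷ ls) C W! =
    removeLeaves u v ((u , v) ∷ (u , x) ∷ (v , x) ∷ []) y l m ls C
      (Unique-⊆ (refl ∷ refl ∷ x ∷ʳ ⊆-refl) (unique-prefix (u ∷ v ∷ x ∷ y ∷ l ∷ m ∷ []) W!))
      (startPoint x y ls C (Unique-⊆ (refl ∷ refl ∷ refl ∷ refl ∷ l ∷ʳ m ∷ʳ ⊆-refl) W!))

  -- The inequality says that `c` is not the only vertex besides `u` and `v`. The base cases treated
  -- directly use up `uv` in whole paths and pass on an empty residue; a point followed by a star
  -- goes through `startPoint`, which passes on two edges.
  startStar : ∀ c ls C → Unique (u ∷ v ∷ c ∷ ls ++ vertices C) → ls ++ vertices C ≢ [] →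
              Decomposes u v ((u , v) ∷ []) (star c ls ∷ C)
  startStar c [] [] W! ≢[] = contradiction refl ≢[]
  -- Twelve edges make four paths: `x`-`u`-`v`-`a`, `x`-`v`-`b`-`a`, `v`-`c`-`u`-`a` and
  -- `u`-`b`-`c`-`a`.
  startStar x [] (triangle a b c ∷ C) W! _ = carve vs (unique-prefix vs W!)
    ((2F ∷ 0F ∷ 1F ∷ 3F ∷ []) ∷ (2F ∷ 1F ∷ 4F ∷ 3F ∷ []) ∷ (1F ∷ 5F ∷ 0F ∷ 3F ∷ []) ∷ (0F ∷ 4F ∷ 5F ∷ 3F ∷ []) ∷ [])
    ((0F , 1F) ∷ (0F , 2F) ∷ (1F , 2F) ∷ (0F , 3F) ∷ (1F , 3F) ∷ (0F , 4F) ∷ (1F , 4F) ∷ (0F , 5F) ∷ (1F , 5F) ∷ [])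
    ((3F , 4F) ∷ (4F , 5F) ∷ (3F , 5F) ∷ [])
    [] [] [] (joins u v (vertices C)) (pieceEdgesOf C)
    (finish u v C (none (pick vs W! (0F ∷ 1F ∷ []))))
    where vs = u ∷ v ∷ x ∷ a ∷ b ∷ c ∷ []
  startStar c [] (star y ls ∷ C) W! _ = startPoint c y ls C W!
  -- The vertices `u`, `v`, `c`, `l` span a K₄, the union of `c`-`v`-`u`-`l` and `u`-`c`-`l`-`v`.
  startStar c (l ∷ []) C W! _ = carve vs (unique-prefix vs W!)
    ((2F ∷ 1F ∷ 0F ∷ 3F ∷ []) ∷ (0F ∷ 2F ∷ 3F ∷ 1F ∷ []) ∷ [])
    ((0F , 1F) ∷ (0F , 2F) ∷ (1F , 2F) ∷ (0F , 3F) ∷ (1F , 3F) ∷ []) ((2F , 3F) ∷ [])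
    [] [] [] (joins u v (vertices C)) (pieceEdgesOf C)
    (finish u v C (none (pick vs W! (0F ∷ 1F ∷ []))))
    where vs = u ∷ v ∷ c ∷ l ∷ []
  -- Removing both leaves would leave the triangle on `u`, `v`, `c`, possibly with no piece to
  -- combine it with. Instead all nine edges are used: `l`-`c`-`m`-`u`, `c`-`u`-`v`-`m` and
  -- `c`-`v`-`l`-`u`.
  startStar c (l ∷ m ∷ []) C W! _ = carve vs (unique-prefix vs W!)
    ((3F ∷ 2F ∷ 4F ∷ 0F ∷ []) ∷ (2F ∷ 0F ∷ 1F ∷ 4F ∷ []) ∷ (2F ∷ 1F ∷ 3F ∷ 0F ∷ []) ∷ [])
    ((0F , 1F) ∷ (0F , 2F) ∷ (1F , 2F) ∷ (0F , 3F) ∷ (1F , 3F) ∷ (0F , 4F) ∷ (1F , 4F) ∷ []) ((2F , 3F) ∷ (2F , 4F) ∷ [])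
    [] [] [] (joins u v (vertices C)) (pieceEdgesOf C)
    (finish u v C (none (pick vs W! (0F ∷ 1F ∷ []))))
    where vs = u ∷ v ∷ c ∷ l ∷ m ∷ []
  -- Two leaves are removed only when a third remains, so the star never shrinks to a lone point.
  startStar c (l ∷ m ∷ k ∷ ls) C W! _ =
    removeLeaves u v ((u , v) ∷ []) c l m (k ∷ ls) C (unique-prefix (u ∷ v ∷ c ∷ l ∷ m ∷ []) W!)
      (startStar c (k ∷ ls) C (Unique-⊆ (refl ∷ refl ∷ refl ∷ l ∷ʳ m ∷ʳ ⊆-refl) W!) λ ())

  -- A triangle must not be split off before a point that would otherwise remain alone.
  startTriangle : ∀ a b c C → Unique (u ∷ v ∷ a ∷ b ∷ c ∷ vertices C) →
                  Decomposes u v ((u , v) ∷ []) (triangle a b c ∷ C)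
  startTriangle a b c [] W! = removeTriangle u v ((u , v) ∷ []) a b c [] W! (stop (_ ∷ []))
  startTriangle a b c (star d ls ∷ C) W! = postpone ((u , v) ∷ []) (triangle a b c) (star d ls) C
    (startStar d ls (triangle a b c ∷ C)
      (Unique-resp-↭ᵛ (↭ᵛ-prep u (↭ᵛ-prep v (↭ᵛ-shifts (a ∷ b ∷ c ∷ []) (d ∷ ls)))) W!)
      -- The postponed triangle supplies the further vertices that `startStar` asks for.
      λ eq → case ++-conicalʳ ls _ eq of λ ())
  startTriangle a b c (triangle a′ b′ c′ ∷ C) W! =
    removeTriangle u v ((u , v) ∷ []) a b c (triangle a′ b′ c′ ∷ C) (unique-prefix (u ∷ v ∷ a ∷ b ∷ c ∷ []) W!)
      (startTriangle a′ b′ c′ C (Unique-⊆ (refl ∷ refl ∷ a ∷ʳ b ∷ʳ c ∷ʳ ⊆-refl) W!))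

  start : ∀ C → Unique (u ∷ v ∷ vertices C) → length (vertices C) ≢ 1 → Decomposes u v ((u , v) ∷ []) C
  start []                   _  _  = stop (_ ∷ [])
  start (star c ls ∷ C)      W! ≢1 = startStar c ls C W! (≢1 ∘ cong (suc ∘ length))
  start (triangle a b c ∷ C) W! _  = startTriangle a b c C W!

-- Absorbing the edges inside W

vertices-↭ : ∀ (vs : List (Fin n)) is js {_ : T (is-just (Matching.match (≡.decSetoid _≟_) is js))} W →
             map (lookup vs) is ++ W ↭ᵛ map (lookup vs) js ++ W
vertices-↭ vs is js {ok} W =
  ++⁺ʳᵛ W (SetoidPermutationProperties.map⁺ (≡.setoid _) (≡.setoid _) (cong (lookup vs)) (to-witness-T _ ok))

infix 4 _≃_
-- Comparing only vertices and edges allows a single edge to be re-rooted at its other end and a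
-- triangle to be read from any corner.
record _≃_ (C D : List (Piece n)) : Set where
  constructor _&_
  field
    sameVertices : vertices C ↭ᵛ vertices D
    sameEdges    : pieceEdgesOf C ↭ pieceEdgesOf D
open _≃_

≃-refl : ∀ {C : List (Piece n)} → C ≃ C
≃-refl = ↭ᵛ-refl & ↭-refl

≃-trans : ∀ {C D E : List (Piece n)} → C ≃ D → D ≃ E → C ≃ E
≃-trans (p & q) (p′ & q′) = ↭ᵛ-trans p p′ & ↭-trans q q′

≃-prep : ∀ (p : Piece n) {C D} → C ≃ D → p ∷ C ≃ p ∷ D
≃-prep p (V & E) = ++⁺ˡᵛ (pieceVertices p) V & ↭-++⁺ˡ (pieceEdges p) E

≃-swap : ∀ (p q : Piece n) C → p ∷ q ∷ C ≃ q ∷ p ∷ C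
≃-swap p q C = ↭ᵛ-shifts (pieceVertices p) (pieceVertices q) & shifts (pieceEdges p) (pieceEdges q)

-- The end of a single edge always counts as a centre. A proper leaf therefore comes with a second
-- leaf `d`, from which a path through `c` to `x` can start.
data Located (x : Fin n) (C : List (Piece n)) : Set where
  centre : ∀ ls D → C ≃ star x ls ∷ D → Located x C
  leaf   : ∀ c d ls D → C ≃ star c (x ∷ d ∷ ls) ∷ D → Located x C
  corner : ∀ a b D → C ≃ triangle x a b ∷ D → Located x C

located-∷ : ∀ p {x : Fin n} {C} → Located x C → Located x (p ∷ C)
located-∷ p (centre ls D C≃)   = centre ls (p ∷ D) (≃-trans (≃-prep p C≃) (≃-swap p _ D))
located-∷ p (leaf c d ls D C≃) = leaf c d ls (p ∷ D) (≃-trans (≃-prep p C≃) (≃-swap p _ D))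
located-∷ p (corner a b D C≃)  = corner a b (p ∷ D) (≃-trans (≃-prep p C≃) (≃-swap p _ D))

locateLeaf : ∀ c ks (x : Fin n) ls C → Located x (star c (ks ++ x ∷ ls) ∷ C)
locateLeaf c []       x []       C = centre (c ∷ []) C
  ( vertices-↭ (c ∷ x ∷ []) (0F ∷ 1F ∷ []) (1F ∷ 0F ∷ []) (vertices C)
  & carve-↭ (c ∷ x ∷ []) [] ((0F , 1F) ∷ []) [] ((1F , 0F) ∷ []) [] [] [] (pieceEdgesOf C) )
locateLeaf c []       x (d ∷ ls) C = leaf c d ls C ≃-refl
locateLeaf c (d ∷ ks) x ls       C = leaf c d (ks ++ ls) C
  ( ++⁺ʳᵛ (vertices C) (↭ᵛ-prep c (↭ᵛ-shift (d ∷ ks) ls))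
  & ↭-++⁺ʳ (pieceEdgesOf C) (begin
      map (c ,_) (d ∷ ks ++ x ∷ ls)               ≡⟨ map-++ (c ,_) (d ∷ ks) (x ∷ ls) ⟩
      map (c ,_) (d ∷ ks) ++ (c , x) ∷ map (c ,_) ls ↭⟨ shifts (map (c ,_) (d ∷ ks)) ((c , x) ∷ []) ⟩
      (c , x) ∷ map (c ,_) (d ∷ ks) ++ map (c ,_) ls ≡⟨ cong ((c , x) ∷_) (map-++ (c ,_) (d ∷ ks) ls) ⟨
      map (c ,_) (x ∷ d ∷ ks ++ ls)               ∎) )
  where open PermutationReasoning

locate : ∀ {x : Fin n} C → x ∈ vertices C → Located x C
locate (p ∷ C) x∈ with ∈-++⁻ (pieceVertices p) x∈
locate (p          ∷ C) _ | inj₂ x∈C         = located-∷ p (locate C x∈C)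
locate (star c ls  ∷ C) _ | inj₁ (here refl) = centre ls C ≃-refl
locate (star c ls  ∷ C) _ | inj₁ (there x∈ls) with ks , ms , refl ← ∈-∃++ x∈ls = locateLeaf c ks _ ms C
locate (triangle a b c ∷ C) _ | inj₁ (here refl) = corner b c C ≃-refl
locate (triangle a b c ∷ C) _ | inj₁ (there (here refl)) = corner a c C
  ( vertices-↭ (a ∷ b ∷ c ∷ []) (0F ∷ 1F ∷ 2F ∷ []) (1F ∷ 0F ∷ 2F ∷ []) (vertices C)
  & carve-↭ (a ∷ b ∷ c ∷ []) [] ((0F , 1F) ∷ (1F , 2F) ∷ (0F , 2F) ∷ []) []
      ((1F , 0F) ∷ (0F , 2F) ∷ (1F , 2F) ∷ []) [] [] [] (pieceEdgesOf C) )
locate (triangle a b c ∷ C) _ | inj₁ (there (there (here refl))) = corner a b C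
  ( vertices-↭ (a ∷ b ∷ c ∷ []) (0F ∷ 1F ∷ 2F ∷ []) (2F ∷ 0F ∷ 1F ∷ []) (vertices C)
  & carve-↭ (a ∷ b ∷ c ∷ []) [] ((0F , 1F) ∷ (1F , 2F) ∷ (0F , 2F) ∷ []) []
      ((2F , 0F) ∷ (0F , 1F) ∷ (2F , 1F) ∷ []) [] [] [] (pieceEdgesOf C) )

-- Vertices are never lost: one whose edges have all gone into paths stays as a point, so the joins
-- to `u` and `v` do not change.
record Absorbs (L : List (Edge n)) (C : List (Piece n)) : Set where
  constructor absorbs
  field
    {paths}      : List (Path n)
    pieces       : List (Piece n)
    distinct     : All Distinct paths
    sameVertices : vertices C ↭ᵛ vertices pieces
    splits       : L ↭ concatMap pathEdges paths ++ pieceEdgesOf pieces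

absorbs-≃ : ∀ {e : Edge n} {C D} → C ≃ D → Absorbs (e ∷ pieceEdgesOf D) D → Absorbs (e ∷ pieceEdgesOf C) C
absorbs-≃ (V & E) (absorbs P d W s) = absorbs P d (↭ᵛ-trans V W) (↭-trans (↭-prep _ E) s)

flipHead : ∀ (x y : Fin n) L → (x , y) ∷ L ↭ (y , x) ∷ L
flipHead x y L = carve-↭ (x ∷ y ∷ []) [] ((0F , 1F) ∷ []) [] ((1F , 0F) ∷ []) [] [] [] L

absorbs-flip : ∀ {x y : Fin n} {L C} → Absorbs ((y , x) ∷ L) C → Absorbs ((x , y) ∷ L) C
absorbs-flip (absorbs P d W s) = absorbs P d W (↭-trans (flipHead _ _ _) s)

-- The path `d`-`c`-`x`-`y` splits off unless `y` is `d`. In that case a third leaf `e` takes the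
-- place of `d`, and without a third leaf the star and the new edge form a triangle.
absorbAtLeaf : ∀ x y c d ls (D : List (Piece n)) → let C = star c (x ∷ d ∷ ls) ∷ D in
               Unique (vertices C) → x ≢ y → Uniqueₑ ((x , y) ∷ pieceEdgesOf C) →
               Absorbs ((x , y) ∷ pieceEdgesOf C) C
absorbAtLeaf x y c d ls D V! x≢y _ with y ≟ d
absorbAtLeaf x y c .y [] D V! x≢y _ | yes refl =
  absorbs (triangle c x y ∷ D) [] ↭ᵛ-refl
    (carve-↭ (c ∷ x ∷ y ∷ []) [] ((1F , 2F) ∷ (0F , 1F) ∷ (0F , 2F) ∷ []) []
      ((0F , 1F) ∷ (1F , 2F) ∷ (0F , 2F) ∷ []) [] [] [] (pieceEdgesOf D))
absorbAtLeaf x y c .y (e ∷ ls) D V! x≢y _ | yes refl =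
  absorbs (star x [] ∷ star e [] ∷ star c (y ∷ ls) ∷ D)
    (pick vs {[]} (unique-prefix vs V!) (3F ∷ 0F ∷ 1F ∷ 2F ∷ []) ∷ [])
    (vertices-↭ vs (0F ∷ 1F ∷ 2F ∷ 3F ∷ []) (1F ∷ 3F ∷ 0F ∷ 2F ∷ []) (ls ++ vertices D))
    (carve-↭ vs ((3F ∷ 0F ∷ 1F ∷ 2F ∷ []) ∷ [])
      ((1F , 2F) ∷ (0F , 1F) ∷ (0F , 2F) ∷ (0F , 3F) ∷ []) []
      ((0F , 2F) ∷ []) [] [] (map (c ,_) ls) (pieceEdgesOf D))
  where vs = c ∷ x ∷ y ∷ e ∷ []
absorbAtLeaf x y c d ls D V! x≢y ((x,y≉c,x ∷ _) ∷ _) | no y≢d =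
  absorbs (star x [] ∷ star d [] ∷ star c ls ∷ D)
    (((d≢c ∷ d≢x ∷ (y≢d ∘ ≡.sym) ∷ []) ∷ (c≢x ∷ c≢y ∷ []) ∷ (x≢y ∷ []) ∷ [] ∷ []) ∷ [])
    (vertices-↭ (c ∷ x ∷ d ∷ []) (0F ∷ 1F ∷ 2F ∷ []) (1F ∷ 2F ∷ 0F ∷ []) (ls ++ vertices D))
    (carve-↭ (c ∷ x ∷ d ∷ y ∷ []) ((2F ∷ 0F ∷ 1F ∷ 3F ∷ []) ∷ [])
      ((1F , 3F) ∷ (0F , 1F) ∷ (0F , 2F) ∷ []) []
      [] [] [] (map (c ,_) ls) (pieceEdgesOf D))
  where
  -- If `y` were the centre, the new edge would already belong to the star.
  c≢y : c ≢ y
  c≢y refl = x,y≉c,x (inj₂ (refl , refl))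
  dcx! = pick (c ∷ x ∷ d ∷ []) V! (2F ∷ 0F ∷ 1F ∷ [])
  d≢c = case dcx! of λ { ((p ∷ _) ∷ _) → p }
  d≢x = case dcx! of λ { ((_ ∷ p ∷ _) ∷ _) → p }
  c≢x = case dcx! of λ { (_ ∷ (p ∷ _) ∷ _) → p }

-- The path `y`-`x`-`a`-`b` splits off, leaving the edge `xb` and the point `a`. Here `y` is neither
-- `a` nor `b`, since the new edge is not a side of the triangle.
absorbAtCorner : ∀ x y a b (D : List (Piece n)) → let C = triangle x a b ∷ D in
                 Unique (vertices C) → x ≢ y → Uniqueₑ ((x , y) ∷ pieceEdgesOf C) →
                 Absorbs ((x , y) ∷ pieceEdgesOf C) C
absorbAtCorner x y a b D ((x≢a ∷ x≢b ∷ _) ∷ (a≢b ∷ _) ∷ _) x≢y ((x,y≉x,a ∷ _ ∷ x,y≉x,b ∷ _) ∷ _) =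
  absorbs (star x (b ∷ []) ∷ star a [] ∷ D)
    (((x≢y ∘ ≡.sym ∷ y≢a ∷ y≢b ∷ []) ∷ (x≢a ∷ x≢b ∷ []) ∷ (a≢b ∷ []) ∷ [] ∷ []) ∷ [])
    (vertices-↭ (x ∷ a ∷ b ∷ []) (0F ∷ 1F ∷ 2F ∷ []) (0F ∷ 2F ∷ 1F ∷ []) (vertices D))
    (carve-↭ (x ∷ a ∷ b ∷ y ∷ []) ((3F ∷ 0F ∷ 1F ∷ 2F ∷ []) ∷ [])
      ((0F , 3F) ∷ (0F , 1F) ∷ (1F , 2F) ∷ (0F , 2F) ∷ []) []
      ((0F , 2F) ∷ []) [] [] [] (pieceEdgesOf D))
  where
  y≢a : y ≢ a
  y≢a refl = x,y≉x,a (inj₁ (refl , refl))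
  y≢b : y ≢ b
  y≢b refl = x,y≉x,b (inj₁ (refl , refl))

-- If one of the stars is a point, it becomes a leaf of the other; otherwise `a`-`x`-`y`-`b` splits
-- off and its two end leaves become points.
absorbAtCentres : ∀ x y ls ms (D : List (Piece n)) → let C = star x ls ∷ star y ms ∷ D in
                  Unique (vertices C) → Absorbs ((x , y) ∷ pieceEdgesOf C) C
absorbAtCentres x y ls []       D V! =
  absorbs (star x (y ∷ ls) ∷ D) [] (↭ᵛ-prep x (↭ᵛ-shift ls (vertices D))) ↭-refl
absorbAtCentres x y [] (b ∷ ms) D V! =
  absorbs (star y (x ∷ b ∷ ms) ∷ D) []
    (vertices-↭ (x ∷ y ∷ []) (0F ∷ 1F ∷ []) (1F ∷ 0F ∷ []) (b ∷ ms ++ vertices D)) (flipHead x y _)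
absorbAtCentres x y (a ∷ ls) (b ∷ ms) D V! =
  absorbs (star a [] ∷ star b [] ∷ star x ls ∷ star y ms ∷ D)
    (unique-prefix (a ∷ x ∷ y ∷ b ∷ []) (Unique-resp-↭ᵛ
       (↭ᵛ-trans reorder (vertices-↭ vs (1F ∷ 3F ∷ 0F ∷ 2F ∷ []) (1F ∷ 0F ∷ 2F ∷ 3F ∷ []) W)) V!) ∷ [])
    (↭ᵛ-trans reorder (↭ᵛ-prep a (↭ᵛ-prep b (↭ᵛ-prep x (↭ᵛ-sym (↭ᵛ-shift ls (ms ++ vertices D)))))))
    (carve-↭ vs ((1F ∷ 0F ∷ 2F ∷ 3F ∷ []) ∷ [])
      ((0F , 2F) ∷ (0F , 1F) ∷ []) ((2F , 3F) ∷ [])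
      [] [] [] (map (x ,_) ls) (map (y ,_) ms ++ pieceEdgesOf D))
  where
  vs = x ∷ a ∷ y ∷ b ∷ []
  W  = ls ++ ms ++ vertices D
  reorder : x ∷ a ∷ ls ++ y ∷ b ∷ ms ++ vertices D ↭ᵛ a ∷ b ∷ x ∷ y ∷ W
  reorder = ↭ᵛ-trans (↭ᵛ-prep x (↭ᵛ-prep a (↭ᵛ-shifts ls (y ∷ b ∷ []))))
                     (vertices-↭ vs (0F ∷ 1F ∷ 2F ∷ 3F ∷ []) (1F ∷ 3F ∷ 0F ∷ 2F ∷ []) W)

-- When `x` is a leaf or a corner, a path through its piece is found without locating `y`. When `x`
-- is a centre, `y` is located among the other pieces: it cannot be a leaf of the same star, as the
-- edge is new.
absorbEdge : ∀ x y (C : List (Piece n)) → Unique (vertices C) → x ≢ y → x ∈ vertices C → y ∈ vertices C →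
             Uniqueₑ ((x , y) ∷ pieceEdgesOf C) → Absorbs ((x , y) ∷ pieceEdgesOf C) C
absorbEdge x y C V! x≢y x∈C y∈C E! with locate C x∈C
... | leaf c d ls D C≃@(V & E) = absorbs-≃ C≃
        (absorbAtLeaf x y c d ls D (Unique-resp-↭ᵛ V V!) x≢y (Uniqueₑ-resp-↭ (↭-prep _ E) E!))
... | corner a b D C≃@(V & E) = absorbs-≃ C≃
        (absorbAtCorner x y a b D (Unique-resp-↭ᵛ V V!) x≢y (Uniqueₑ-resp-↭ (↭-prep _ E) E!))
... | centre ls D C≃@(V & E) = secondEnd (∈-++⁻ (x ∷ ls) (∈-resp-↭ᵛ V y∈C))
  where
  p = star x ls
  y,x! : ∀ {q D′} → C ≃ q ∷ p ∷ D′ → Uniqueₑ ((y , x) ∷ pieceEdgesOf (q ∷ p ∷ D′))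
  y,x! (_ & E) = Uniqueₑ-resp-↭ (↭-trans (flipHead x y _) (↭-prep _ E)) E!
  past : ∀ {q D′} → D ≃ q ∷ D′ → C ≃ q ∷ p ∷ D′
  past D≃ = ≃-trans C≃ (≃-trans (≃-prep p D≃) (≃-swap p _ _))
  secondEnd : y ∈ x ∷ ls ⊎ y ∈ vertices D → Absorbs ((x , y) ∷ pieceEdgesOf C) C
  secondEnd (inj₁ (here refl))  = contradiction refl x≢y
  secondEnd (inj₁ (there y∈ls)) =
    case Uniqueₑ-resp-↭ (↭-prep _ E) E! of λ { (x,y∉ ∷ _) →
      contradiction (inj₁ (refl , refl)) (All.lookup x,y∉ (∈-++⁺ˡ (∈-map⁺ (x ,_) y∈ls))) }
  secondEnd (inj₂ y∈D) with locate D y∈D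
  ... | leaf c d ms D′ D≃ = absorbs-flip (absorbs-≃ (past D≃)
          (absorbAtLeaf y x c d ms (p ∷ D′) (Unique-resp-↭ᵛ (sameVertices (past D≃)) V!) (x≢y ∘ ≡.sym) (y,x! (past D≃))))
  ... | corner a b D′ D≃ = absorbs-flip (absorbs-≃ (past D≃)
          (absorbAtCorner y x a b (p ∷ D′) (Unique-resp-↭ᵛ (sameVertices (past D≃)) V!) (x≢y ∘ ≡.sym) (y,x! (past D≃))))
  ... | centre ms D′ D≃ =
          let C≃′ = ≃-trans C≃ (≃-prep p D≃)
          in absorbs-≃ C≃′ (absorbAtCentres x y ls ms D′ (Unique-resp-↭ᵛ (sameVertices C≃′) V!))

Within : List (Fin n) → Edge n → Set
Within W (x , y) = x ≢ y × x ∈ W × y ∈ W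

-- Freedom from repetition is assumed for `H` and the piece edges jointly. Being invariant under
-- permutation, it survives the splitting off of paths and guarantees that each edge is new to the
-- pieces it meets.
absorbAll : ∀ H (C : List (Piece n)) → Unique (vertices C) → All (Within (vertices C)) H →
            Uniqueₑ (H ++ pieceEdgesOf C) → Absorbs (H ++ pieceEdgesOf C) C
absorbAll []            C V! _                         _           = absorbs C [] ↭ᵛ-refl ↭-refl
absorbAll ((x , y) ∷ H) C V! ((x≢y , x∈C , y∈C) ∷ ins) HE!@(_ ∷ E!)
  with absorbs {ps} D ds V s ← absorbAll H C V! ins E!
  with absorbs {qs} D′ ds′ V′ s′ ←
    absorbEdge x y D (Unique-resp-↭ᵛ V V!) x≢y (∈-resp-↭ᵛ V x∈C) (∈-resp-↭ᵛ V y∈C)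
      (proj₁ (proj₂ (AllPairs-++⁻ (concatMap pathEdges ps)
        (Uniqueₑ-resp-↭ (↭-trans (↭-prep _ s) (shifts ((x , y) ∷ []) (concatMap pathEdges ps))) HE!))))
  = absorbs D′ (All.++⁺ ds ds′) (↭ᵛ-trans V V′) (begin
      (x , y) ∷ H ++ pieceEdgesOf C               ↭⟨ ↭-prep _ s ⟩
      (x , y) ∷ P ++ pieceEdgesOf D               ↭⟨ shifts ((x , y) ∷ []) P ⟩
      P ++ (x , y) ∷ pieceEdgesOf D               ↭⟨ ↭-++⁺ˡ P s′ ⟩
      P ++ Q ++ pieceEdgesOf D′                   ≡⟨ ++-assoc P Q _ ⟨
      (P ++ Q) ++ pieceEdgesOf D′                 ≡⟨ cong (_++ pieceEdgesOf D′) (concatMap-++ pathEdges ps qs) ⟨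
      concatMap pathEdges (ps ++ qs) ++ pieceEdgesOf D′ ∎)
  where
  open PermutationReasoning
  P = concatMap pathEdges ps
  Q = concatMap pathEdges qs

-- The edge list of a graph, up to orientation.

≈-adj : (Γ : Graph (Fin n)) → ∀ {x y e} → singleEdge e x y → Adj Γ (proj₁ e) (proj₂ e) → Adj Γ x y
≈-adj Γ (inj₁ (refl , refl)) = id
≈-adj Γ (inj₂ (refl , refl)) = symm Γ

module _ (Γ : Graph (Fin n)) where

  ∈edges⇒adj : ∀ {x y} → (x , y) ∈ edges Γ → Adj Γ x y
  ∈edges⇒adj e∈ = proj₂ (proj₂ (∈-filter⁻ (λ (x , y) → (x <? y) ×-dec adj? Γ x y) {xs = cartesianProduct (allFin n) (allFin n)} e∈))

  ∈ₑ⇒adj : ∀ {x y} → (x , y) ∈ₑ edges Γ → Adj Γ x y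
  ∈ₑ⇒adj e∈ = let f , f∈ , e≈f = find e∈ in ≈-adj Γ e≈f (∈edges⇒adj f∈)

  adj⇒∈ₑ : ∀ {x y} → Adj Γ x y → (x , y) ∈ₑ edges Γ
  adj⇒∈ₑ {x} {y} xy with <-cmp x y
  ... | tri< x<y _ _ = lose (∈-filter⁺ _ (∈-cartesianProduct⁺ (∈-allFin x) (∈-allFin y)) (x<y , xy)) (inj₁ (refl , refl))
  ... | tri≈ _ x≡y _ = contradiction xy (irrefl Γ x≡y)
  ... | tri> _ _ y<x = lose (∈-filter⁺ _ (∈-cartesianProduct⁺ (∈-allFin y) (∈-allFin x)) (y<x , symm Γ xy)) (inj₂ (refl , refl))

  -- All pairs are listed with the smaller vertex first, so distinct pairs cannot be reversals of
  -- each other.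
  edges-unique : Uniqueₑ (edges Γ)
  edges-unique = AllPairs-zip oriented (Unique.filter⁺ _ (Unique.cartesianProduct⁺ (Unique.allFin⁺ n) (Unique.allFin⁺ n)))
    (All.map proj₁ (All.all-filter (λ (x , y) → (x <? y) ×-dec adj? Γ x y) (cartesianProduct (allFin n) (allFin n))))
    where
    oriented : ∀ {e f : Edge n} → proj₁ e < proj₂ e → proj₁ f < proj₂ f → e ≢ f → ¬ singleEdge f (proj₁ e) (proj₂ e)
    oriented _   _   e≢f (inj₁ (refl , refl)) = e≢f refl
    oriented x<y y<x _   (inj₂ (refl , refl)) = <-asym x<y y<x
    AllPairs-zip : ∀ {A : Set} {P : A → Set} {R S : A → A → Set} → (∀ {x y} → P x → P y → R x y → S x y) →
                   ∀ {xs} → AllPairs R xs → All P xs → AllPairs S xs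
    AllPairs-zip f []        []         = []
    AllPairs-zip f (rs ∷ rss) (px ∷ pxs) = All.zipWith (λ (r , p) → f px p r) (rs , pxs) ∷ AllPairs-zip f rss pxs

-- Graphs with two universal vertices

-- If `x` were not a neighbour, then `u`, `x` and the neighbours of `u` would be n + 1 distinct
-- vertices.
degree≡n-1⇒universal : (Γ : Graph (Fin n)) → ∀ u → degree Γ u ≡ n ∸ 1 → ∀ {x} → x ≢ u → Adj Γ u x
degree≡n-1⇒universal {suc m} Γ u deg {x} x≢u with adj? Γ u x
... | yes ux = ux
... | no ¬ux = contradiction
  (subst₂ _≤_ (cong (2 +_) deg) (length-tabulate {n = suc m} id)
    (UniqueLists.⊆⇒length≤ (≡.setoid _) {ys = allFin (suc m)} ux∷nbrs! λ {y} _ → ∈-allFin y))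
  1+n≰n
  where
  nbrs = filter (adj? Γ u) (allFin (suc m))
  nbr : ∀ {y} → y ∈ nbrs → Adj Γ u y
  nbr = proj₂ ∘ ∈-filter⁻ (adj? Γ u) {xs = allFin (suc m)}
  ux∷nbrs! : Unique (u ∷ x ∷ nbrs)
  ux∷nbrs! = ((x≢u ∘ ≡.sym) ∷ All.tabulate (λ y∈ → λ { refl → irrefl Γ refl (nbr y∈) })) ∷
             All.tabulate (λ y∈ → λ { refl → ¬ux (nbr y∈) }) ∷
             Unique.filter⁺ (adj? Γ u) (Unique.allFin⁺ (suc m))

All-joins : ∀ {u v : Fin n} {P : Edge n → Set} {W} → All (λ w → P (u , w) × P (v , w)) W → All P (joins u v W)
All-joins []              = []
All-joins ((pu , pv) ∷ ps) = pu ∷ pv ∷ All-joins ps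

∈-joins : ∀ {u v w : Fin n} {W} → w ∈ W → (u , w) ∈ joins u v W × (v , w) ∈ joins u v W
∈-joins (here refl) = here refl , there (here refl)
∈-joins (there w∈)  = let p , q = ∈-joins w∈ in there (there p) , there (there q)

joins-unique : ∀ {u v : Fin n} {W} → Unique (u ∷ v ∷ W) → Uniqueₑ (joins u v W)
joins-unique {W = []}    _ = []
joins-unique {u = u} {v} {w ∷ W} ((u≢v ∷ u≢w ∷ u∉) ∷ (v≢w ∷ v∉) ∷ w∉ ∷ W!) =
  ((λ { (inj₁ (refl , _)) → u≢v refl ; (inj₂ (refl , _)) → u≢w refl }) ∷ All-joins (All.zipWith (λ (u≢x , w≢x) →
      (λ { (inj₁ (_ , refl)) → w≢x refl ; (inj₂ (_ , refl)) → u≢w refl })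
    , (λ { (inj₁ (_ , refl)) → w≢x refl ; (inj₂ (refl , _)) → u≢x refl })) (u∉ , w∉))) ∷
  All-joins (All.zipWith (λ (v≢x , w≢x) →
      (λ { (inj₁ (_ , refl)) → w≢x refl ; (inj₂ (refl , _)) → v≢x refl })
    , (λ { (inj₁ (_ , refl)) → w≢x refl ; (inj₂ (_ , refl)) → v≢w refl })) (v∉ , w∉)) ∷
  joins-unique ((u≢v ∷ u∉) ∷ v∉ ∷ W!)

points : List (Fin n) → List (Piece n)
points = map λ w → star w []

vertices-points : ∀ (W : List (Fin n)) → vertices (points W) ≡ W
vertices-points []      = refl
vertices-points (w ∷ W) = cong (w ∷_) (vertices-points W)

edges-points : ∀ (W : List (Fin n)) → pieceEdgesOf (points W) ≡ []
edges-points []      = refl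
edges-points (w ∷ W) = edges-points W

module _ (Γ : Graph (Fin n)) {u v : Fin n} (u≢v : u ≢ v)
         (u-universal : ∀ {x} → x ≢ u → Adj Γ u x) (v-universal : ∀ {x} → x ≢ v → Adj Γ v x) where

  other? : ∀ x → Dec (x ≢ u × x ≢ v)
  other? x = ¬? (x ≟ u) ×-dec ¬? (x ≟ v)

  others : List (Fin n)
  others = filter other? (allFin n)

  other : ∀ {x} → x ∈ others → x ≢ u × x ≢ v
  other = proj₂ ∘ ∈-filter⁻ other? {xs = allFin n}

  uv∷others! : Unique (u ∷ v ∷ others)
  uv∷others! = (u≢v ∷ All.tabulate (λ x∈ → proj₁ (other x∈) ∘ ≡.sym)) ∷
               All.tabulate (λ x∈ → proj₂ (other x∈) ∘ ≡.sym) ∷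
               Unique.filter⁺ other? (Unique.allFin⁺ n)

  covers : ∀ x → x ∈ u ∷ v ∷ others
  covers x with x ≟ u | x ≟ v
  ... | yes refl | _        = here refl
  ... | _        | yes refl = there (here refl)
  ... | no x≢u   | no x≢v   = there (there (∈-filter⁺ other? (∈-allFin x) (x≢u , x≢v)))

  n≡2+others : n ≡ 2 + length others
  n≡2+others = ≡.trans (≡.sym (length-tabulate {n = n} id))
    (↭ᵛ-length (UniqueLists.sameElements⇒↭ (≡.setoid _) uv∷others! (Unique.allFin⁺ n) (λ {x} _ → ∈-allFin x) (λ {x} _ → covers x)))

  inner? : (e : Edge n) → Dec (proj₁ e ∈ others × proj₂ e ∈ others)
  inner? (x , y) = (x ∈? others) ×-dec (y ∈? others)

  inner : List (Edge n)
  inner = filter inner? (edges Γ)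

  ∈inner⁻ : ∀ {e} → e ∈ inner → e ∈ edges Γ × proj₁ e ∈ others × proj₂ e ∈ others
  ∈inner⁻ = ∈-filter⁻ inner? {xs = edges Γ}

  split! : Uniqueₑ ((u , v) ∷ joins u v others ++ inner)
  split! = All.++⁺
      (All-joins (All.tabulate λ x∈ → let x≢u , x≢v = other x∈ in
          (λ { (inj₁ (_ , refl)) → x≢v refl ; (inj₂ (refl , _)) → x≢u refl })
        , (λ { (inj₁ (refl , _)) → u≢v refl ; (inj₂ (refl , _)) → x≢u refl })))
      (All.tabulate λ e∈ → let _ , x∈ , y∈ = ∈inner⁻ e∈ in
          λ { (inj₁ (refl , _)) → proj₁ (other x∈) refl ; (inj₂ (refl , _)) → proj₁ (other y∈) refl })
    ∷ AllPairs.++⁺ (joins-unique uv∷others!) (AllPairs.filter⁺ inner? (edges-unique Γ))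
      (All-joins (All.universal (λ w →
          All.tabulate (λ e∈ → let _ , x∈ , y∈ = ∈inner⁻ e∈ in
            λ { (inj₁ (refl , _)) → proj₁ (other x∈) refl ; (inj₂ (refl , _)) → proj₁ (other y∈) refl })
        , All.tabulate (λ e∈ → let _ , x∈ , y∈ = ∈inner⁻ e∈ in
            λ { (inj₁ (refl , _)) → proj₂ (other x∈) refl ; (inj₂ (refl , _)) → proj₂ (other y∈) refl })) others))

  split-adj : All (λ (x , y) → Adj Γ x y) ((u , v) ∷ joins u v others ++ inner)
  split-adj = u-universal (u≢v ∘ ≡.sym) ∷ All.++⁺
    (All-joins (All.tabulate λ x∈ → let x≢u , x≢v = other x∈ in u-universal x≢u , v-universal x≢v))
    (All.tabulate (∈edges⇒adj Γ ∘ proj₁ ∘ ∈inner⁻))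

  adj⇒∈split : ∀ {x y} → Adj Γ x y → (x , y) ∈ₑ (u , v) ∷ joins u v others ++ inner
  adj⇒∈split {x} {y} xy with covers x | covers y
  ... | here refl            | here refl            = contradiction xy (irrefl Γ refl)
  ... | here refl            | there (here refl)    = here (inj₁ (refl , refl))
  ... | here refl            | there (there y∈)     = lose (there (∈-++⁺ˡ (proj₁ (∈-joins {u = u} {v} y∈)))) (inj₁ (refl , refl))
  ... | there (here refl)    | here refl            = here (inj₂ (refl , refl))
  ... | there (here refl)    | there (here refl)    = contradiction xy (irrefl Γ refl)
  ... | there (here refl)    | there (there y∈)     = lose (there (∈-++⁺ˡ (proj₂ (∈-joins {u = u} {v} y∈)))) (inj₁ (refl , refl))
  ... | there (there x∈)     | here refl            = lose (there (∈-++⁺ˡ (proj₁ (∈-joins {u = u} {v} x∈)))) (inj₂ (refl , refl))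
  ... | there (there x∈)     | there (here refl)    = lose (there (∈-++⁺ˡ (proj₂ (∈-joins {u = u} {v} x∈)))) (inj₂ (refl , refl))
  ... | there (there x∈)     | there (there y∈) with find (adj⇒∈ₑ Γ xy)
  ... | e , e∈ , e≈@(inj₁ (refl , refl)) = lose (there (∈-++⁺ʳ _ (∈-filter⁺ inner? e∈ (x∈ , y∈)))) e≈
  ... | e , e∈ , e≈@(inj₂ (refl , refl)) = lose (there (∈-++⁺ʳ _ (∈-filter⁺ inner? e∈ (y∈ , x∈)))) e≈

  -- Neither list repeats an edge, so it suffices to compare members: an edge is `uv`, has exactly
  -- one end among `u` and `v`, or lies within `others`; universality supplies the converse.
  edges-split : edges Γ ↭ (u , v) ∷ joins u v others ++ inner
  edges-split = UniqueLists.sameElements⇒↭ (edgeSetoid n) split! (edges-unique Γ)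
    (λ e∈ → let f , f∈ , e≈f = find e∈ in adj⇒∈ₑ Γ (≈-adj Γ e≈f (All.lookup split-adj f∈)))
    (adj⇒∈split ∘ ∈ₑ⇒adj Γ)

  -- Absorption starts from isolated points, which carry no edges, and returns pieces on the same
  -- vertices; hence the joins of `others` are those of the pieces, and `start` applies.
  nearDecomposition : n ≢ 3 → NearDecomposition (edges Γ)
  nearDecomposition n≢3
    with absorbs {ps} D ds V s ← absorbAll inner (points others)
      (subst Unique (≡.sym (vertices-points others)) (case uv∷others! of λ { (_ ∷ _ ∷ W!) → W! }))
      (subst (λ W → All (Within W) inner) (≡.sym (vertices-points others)) (All.tabulate λ e∈ →
        let e∈Γ , x∈ , y∈ = ∈inner⁻ e∈ in (λ x≡y → irrefl Γ x≡y (∈edges⇒adj Γ e∈Γ)) , x∈ , y∈))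
      (subst (λ E → Uniqueₑ (inner ++ E)) (≡.sym (edges-points others))
        (subst Uniqueₑ (≡.sym (++-identityʳ inner)) (AllPairs.filter⁺ inner? (edges-unique Γ))))
    = respects (↭-trans edges-split rearrange)
        (addPaths ds (start u v D (Unique-resp-↭ᵛ (↭ᵛ-prep u (↭ᵛ-prep v V′)) uv∷others!) ≢1))
    where
    V′ : others ↭ᵛ vertices D
    V′ = subst (_↭ᵛ vertices D) (vertices-points others) V
    -- A single vertex besides `u` and `v` would make Γ the graph K₃; this is where `n ≢ 3` enters.
    ≢1 : length (vertices D) ≢ 1
    ≢1 eq = n≢3 (≡.trans n≡2+others (cong (2 +_) (≡.trans (↭ᵛ-length V′) eq)))
    rearrange : (u , v) ∷ joins u v others ++ inner ↭
                concatMap pathEdges ps ++ (u , v) ∷ joins u v (vertices D) ++ pieceEdgesOf D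
    rearrange = begin
      (u , v) ∷ joins u v others ++ inner
        ↭⟨ ↭-prep _ (++⁺ (joins-↭ u v V′) (subst (_↭ _) (≡.trans (cong (inner ++_) (edges-points others)) (++-identityʳ inner)) s)) ⟩
      ((u , v) ∷ joins u v (vertices D)) ++ concatMap pathEdges ps ++ pieceEdgesOf D
        ↭⟨ shifts ((u , v) ∷ joins u v (vertices D)) (concatMap pathEdges ps) ⟩
      concatMap pathEdges ps ++ (u , v) ∷ joins u v (vertices D) ++ pieceEdgesOf D ∎
      where open PermutationReasoning

-- Paths as subgraphs

vertexSet : List (Fin n) → Subset n
vertexSet xs = Subset.⋃ (map Subset.⁅_⁆ xs)

∈-vertexSet⁺ : ∀ {xs} {x : Fin n} → x ∈ xs → x Subset.∈ vertexSet xs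
∈-vertexSet⁺ (here refl) = Subset.x∈p∪q⁺ (inj₁ (Subset.x∈⁅x⁆ _))
∈-vertexSet⁺ (there x∈)  = Subset.x∈p∪q⁺ (inj₂ (∈-vertexSet⁺ x∈))

∈-vertexSet⁻ : ∀ xs {x : Fin n} → x Subset.∈ vertexSet xs → x ∈ xs
∈-vertexSet⁻ []       x∈ = contradiction x∈ Subset.∉⊥
∈-vertexSet⁻ (y ∷ xs) x∈ with Subset.x∈p∪q⁻ Subset.⁅ y ⁆ (vertexSet xs) x∈
... | inj₁ x∈⁅y⁆ = here (Subset.x∈⁅y⁆⇒x≡y y x∈⁅y⁆)
... | inj₂ x∈xs  = there (∈-vertexSet⁻ xs x∈xs)

vertices-≡ : ∀ {S : Subset n} {x y : ∃ (Subset._∈ S)} → proj₁ x ≡ proj₁ y → x ≡ y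
vertices-≡ {x = x , _} refl = cong (x ,_) ([]=-irrelevant _ _)

trace : (Fin 4 → Fin n) → Path n
trace f = f 0F ∷ f 1F ∷ f 2F ∷ f 3F ∷ []

trace-adjacent : ∀ (f : Fin 4 → Fin n) {i j} → Adj P₄ i j → (f i , f j) ∈ₑ pathEdges (trace f)
trace-adjacent f {0F} {1F} (inj₁ refl) = here (inj₁ (refl , refl))
trace-adjacent f {1F} {2F} (inj₁ refl) = there (here (inj₁ (refl , refl)))
trace-adjacent f {2F} {3F} (inj₁ refl) = there (there (here (inj₁ (refl , refl))))
trace-adjacent f {1F} {0F} (inj₂ refl) = here (inj₂ (refl , refl))
trace-adjacent f {2F} {1F} (inj₂ refl) = there (here (inj₂ (refl , refl)))
trace-adjacent f {3F} {2F} (inj₂ refl) = there (there (here (inj₂ (refl , refl))))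
trace-adjacent f {3F} {0F} (inj₁ ())
trace-adjacent f {3F} {1F} (inj₁ ())
trace-adjacent f {3F} {2F} (inj₁ ())
trace-adjacent f {3F} {3F} (inj₁ ())

trace-adjacent⁻ : ∀ (f : Fin 4 → Fin n) {x y} → (x , y) ∈ₑ pathEdges (trace f) →
                  ∃₂ λ i j → Adj P₄ i j × f i ≡ x × f j ≡ y
trace-adjacent⁻ f (here (inj₁ (refl , refl)))                 = 0F , 1F , inj₁ refl , refl , refl
trace-adjacent⁻ f (here (inj₂ (refl , refl)))                 = 1F , 0F , inj₂ refl , refl , refl
trace-adjacent⁻ f (there (here (inj₁ (refl , refl))))         = 1F , 2F , inj₁ refl , refl , refl
trace-adjacent⁻ f (there (here (inj₂ (refl , refl))))         = 2F , 1F , inj₂ refl , refl , refl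
trace-adjacent⁻ f (there (there (here (inj₁ (refl , refl))))) = 2F , 3F , inj₁ refl , refl , refl
trace-adjacent⁻ f (there (there (here (inj₂ (refl , refl))))) = 3F , 2F , inj₂ refl , refl , refl

flip-∈ₑ : ∀ {x y : Fin n} L → (x , y) ∈ₑ L → (y , x) ∈ₑ L
flip-∈ₑ L = MembershipSetoidProperties.∈-resp-≈ (edgeSetoid _) {xs = L} (inj₂ (refl , refl))

∈ₑ-ends : ∀ {x y : Fin n} p → (x , y) ∈ₑ pathEdges p → x ∈ toList p × y ∈ toList p
∈ₑ-ends p@(a ∷ b ∷ c ∷ d ∷ []) e∈ with trace-adjacent⁻ (lookup (toList p)) e∈
... | i , j , _ , refl , refl = ∈-lookup i , ∈-lookup j

module _ (Γ : Graph (Fin n)) where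

  pathSubgraph : ∀ p → (∀ {x y} → (x , y) ∈ₑ pathEdges p → Adj Γ x y) → Subgraph Γ
  pathSubgraph p p⊆Γ = record
    { vertices = vertexSet (toList p)
    ; graph    = record
      { Adj    = λ x y → (proj₁ x , proj₁ y) ∈ₑ pathEdges p
      ; adj?   = λ x y → Any.any? (DecSetoid._≟_ (edgeDecSetoid n) (proj₁ x , proj₁ y)) (pathEdges p)
      ; symm   = flip-∈ₑ (pathEdges p)
      ; irrefl = λ { refl → irrefl Γ refl ∘ p⊆Γ }
      }
    ; included = p⊆Γ
    }

  module _ p (p⊆Γ : ∀ {x y} → (x , y) ∈ₑ pathEdges p → Adj Γ x y) where

    edgeSet⇒∈ₑ : ∀ {x y} → edgeSet (pathSubgraph p p⊆Γ) x y → (x , y) ∈ₑ pathEdges p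
    edgeSet⇒∈ₑ (_ , _ , e∈) = e∈

    ∈ₑ⇒edgeSet : ∀ {x y} → (x , y) ∈ₑ pathEdges p → edgeSet (pathSubgraph p p⊆Γ) x y
    ∈ₑ⇒edgeSet e∈ = let x∈ , y∈ = ∈ₑ-ends p e∈ in ∈-vertexSet⁺ x∈ , ∈-vertexSet⁺ y∈ , e∈

  -- Positions correspond to vertices; the inverse reads off the index of a membership proof.
  -- Distinctness makes the two inverse and brings consecutive vertices back to consecutive
  -- positions.
  pathSubgraph-P₄ : ∀ p (p⊆Γ : ∀ {x y} → (x , y) ∈ₑ pathEdges p → Adj Γ x y) → Distinct p →
                    P₄ ≅ Subgraph.graph (pathSubgraph p p⊆Γ)
  pathSubgraph-P₄ p@(_ ∷ _ ∷ _ ∷ _ ∷ []) p⊆Γ p! = record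
    { bijection = mk↔ₛ′
        (λ i → f i , ∈-vertexSet⁺ (∈-lookup {xs = toList p} i))
        (λ (x , x∈) → Any.index (∈-vertexSet⁻ (toList p) x∈))
        (λ (x , x∈) → vertices-≡ (≡.sym (Any.lookup-index (∈-vertexSet⁻ (toList p) x∈))))
        (λ i → lookup-injective p! (≡.sym (Any.lookup-index (∈-vertexSet⁻ (toList p) (∈-vertexSet⁺ (∈-lookup {xs = toList p} i))))))
    ; adjacency = λ i j → mk⇔ (trace-adjacent f) λ e∈ →
        let i′ , j′ , ij , fi , fj = trace-adjacent⁻ f e∈
        in subst₂ (Adj P₄) (lookup-injective p! fi) (lookup-injective p! fj) ij
    }
    where
    f : Fin 4 → Fin n
    f = lookup (toList p)

-- From edge lists to decompositions

module _ {A : Set} (f : A → List (Edge n)) where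

  ∈-block⁺ : ∀ {e} xs i → e ∈ₑ f (lookup xs i) → e ∈ₑ concatMap f xs
  ∈-block⁺ (x ∷ xs) zero    e∈ = MembershipSetoidProperties.∈-++⁺ˡ (edgeSetoid n) e∈
  ∈-block⁺ (x ∷ xs) (suc i) e∈ = MembershipSetoidProperties.∈-++⁺ʳ (edgeSetoid n) (f x) (∈-block⁺ xs i e∈)

  ∈-block⁻ : ∀ {e} xs → e ∈ₑ concatMap f xs → ∃ λ i → e ∈ₑ f (lookup xs i)
  ∈-block⁻ (x ∷ xs) e∈ with MembershipSetoidProperties.∈-++⁻ (edgeSetoid n) (f x) e∈
  ... | inj₁ e∈x  = zero , e∈x
  ... | inj₂ e∈xs = let i , p = ∈-block⁻ xs e∈xs in suc i , p

disjoint : ∀ {e : Edge n} xs {ys} → Uniqueₑ (xs ++ ys) → e ∈ₑ xs → e ∈ₑ ys → ⊥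
disjoint {n} xs xs++ys! e∈xs e∈ys =
  let _ , _ , xs#ys = AllPairs-++⁻ xs xs++ys!
      x , x∈ , e≈x = find e∈xs
      y , y∈ , e≈y = find e∈ys
  in All.lookup (All.lookup xs#ys x∈) y∈ (DecSetoid.trans (edgeDecSetoid n) (DecSetoid.sym (edgeDecSetoid n) e≈x) e≈y)

block-unique : ∀ {A : Set} (f : A → List (Edge n)) {e} xs → Uniqueₑ (concatMap f xs) →
               ∀ i j → e ∈ₑ f (lookup xs i) → e ∈ₑ f (lookup xs j) → i ≡ j
block-unique f (x ∷ xs) _  zero    zero    _  _  = refl
block-unique f (x ∷ xs) u! zero    (suc j) p  q  = ⊥-elim (disjoint (f x) u! p (∈-block⁺ f xs j q))
block-unique f (x ∷ xs) u! (suc i) zero    p  q  = ⊥-elim (disjoint (f x) u! q (∈-block⁺ f xs i p))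
block-unique f (x ∷ xs) u! (suc i) (suc j) p  q  =
  cong suc (block-unique f xs (proj₁ (proj₂ (AllPairs-++⁻ (f x) u!))) i j p q)

pathEdges-unique : ∀ (p : Path n) → Distinct p → Uniqueₑ (pathEdges p)
pathEdges-unique (a ∷ b ∷ c ∷ d ∷ []) ((a≢b ∷ a≢c ∷ a≢d ∷ []) ∷ (b≢c ∷ b≢d ∷ []) ∷ _) =
  ( (λ { (inj₁ (a≡b , _)) → a≢b a≡b ; (inj₂ (a≡c , _)) → a≢c a≡c })
  ∷ (λ { (inj₁ (a≡c , _)) → a≢c a≡c ; (inj₂ (a≡d , _)) → a≢d a≡d }) ∷ []) ∷
  ((λ { (inj₁ (b≡c , _)) → b≢c b≡c ; (inj₂ (b≡d , _)) → b≢d b≡d }) ∷ []) ∷ [] ∷ []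

length-concatMap-pathEdges : ∀ (ps : List (Path n)) → length (concatMap pathEdges ps) ≡ length ps * 3
length-concatMap-pathEdges []                             = refl
length-concatMap-pathEdges ((_ ∷ _ ∷ _ ∷ _ ∷ []) ∷ ps) = cong (3 +_) (length-concatMap-pathEdges ps)

module _ (Γ : Graph (Fin n)) where

  remainder : (N : NearDecomposition (edges Γ)) → ∣E∣ Γ % 3 ≡ length (NearDecomposition.remaining N)
  remainder (near {ps} {rs} _ short splits) = begin
    ∣E∣ Γ % 3                                             ≡⟨ cong (_% 3) (↭-length splits) ⟩
    length (concatMap pathEdges ps ++ rs) % 3             ≡⟨ cong (_% 3) (length-++ (concatMap pathEdges ps)) ⟩
    (length (concatMap pathEdges ps) + length rs) % 3     ≡⟨ cong (λ l → (l + length rs) % 3) (length-concatMap-pathEdges ps) ⟩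
    (length ps * 3 + length rs) % 3                       ≡⟨ cong (_% 3) (+-comm (length ps * 3) (length rs)) ⟩
    (length rs + length ps * 3) % 3                       ≡⟨ [m+kn]%n≡m%n (length rs) (length ps) 3 ⟩
    length rs % 3                                         ≡⟨ m<n⇒m%n≡m (s≤s short) ⟩
    length rs                                             ∎
    where open ≡.≡-Reasoning

  withRemainder : (N : NearDecomposition (edges Γ)) →
                  P₄-DecompositionWithRemainder Γ (length (NearDecomposition.remaining N))
  withRemainder (near {ps} {rs} ds _ splits) = record
    { k         = length ps
    ; paths     = λ i → pathSubgraph Γ (lookup ps i) (p⊆Γ i)
    ; isP₄      = λ i → pathSubgraph-P₄ Γ (lookup ps i) (p⊆Γ i) (All.lookup ds (∈-lookup i))
    ; remaining = lookup rs
    ; partition = record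
      { nonempty = nonempty
      ; included = included
      ; unique   = λ {x} {y} xy → unique (MembershipSetoidProperties.∈-++⁻ (edgeSetoid n) P (∈ₑ-resp-↭ splits (adj⇒∈ₑ Γ xy)))
      }
    }
    where
    P = concatMap pathEdges ps
    -- Single edges are viewed as blocks of length one, so that `block-unique` covers them as well.
    R = concatMap (_∷ []) rs
    parts! : Uniqueₑ (P ++ rs)
    parts! = Uniqueₑ-resp-↭ splits (edges-unique Γ)
    adj : ∀ {x y} → (x , y) ∈ₑ P ++ rs → Adj Γ x y
    adj e∈ = ∈ₑ⇒adj Γ (∈ₑ-resp-↭ (↭-sym splits) e∈)
    p⊆Γ : ∀ i {x y} → (x , y) ∈ₑ pathEdges (lookup ps i) → Adj Γ x y
    p⊆Γ i e∈ = adj (MembershipSetoidProperties.∈-++⁺ˡ (edgeSetoid n) (∈-block⁺ pathEdges ps i e∈))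
    Part : Fin (length ps) ⊎ Fin (length rs) → EdgeSet n
    Part = [ (λ i → edgeSet (pathSubgraph Γ (lookup ps i) (p⊆Γ i))) , (λ j → singleEdge (lookup rs j)) ]
    edge∈rs : ∀ j {x y} → singleEdge (lookup rs j) x y → (x , y) ∈ₑ rs
    edge∈rs j e≈ = lose (∈-lookup j) e≈
    included : ∀ i {x y} → Part i x y → Adj Γ x y
    included (inj₁ i) e∈ = p⊆Γ i (edgeSet⇒∈ₑ Γ (lookup ps i) (p⊆Γ i) e∈)
    included (inj₂ j) e≈ = adj (MembershipSetoidProperties.∈-++⁺ʳ (edgeSetoid n) P (edge∈rs j e≈))
    nonempty : ∀ i → ∃₂ (Part i)
    nonempty (inj₁ i) = nonemptyPath (lookup ps i) (p⊆Γ i)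
      where
      nonemptyPath : ∀ p (p⊆Γ : ∀ {x y} → (x , y) ∈ₑ pathEdges p → Adj Γ x y) → ∃₂ (edgeSet (pathSubgraph Γ p p⊆Γ))
      nonemptyPath p@(a ∷ b ∷ _ ∷ _ ∷ []) p⊆Γ = a , b , ∈ₑ⇒edgeSet Γ p p⊆Γ (here (inj₁ (refl , refl)))
    nonempty (inj₂ j) = _ , _ , inj₁ (refl , refl)
    P! : Uniqueₑ P
    P! = proj₁ (AllPairs-++⁻ P parts!)
    R! : Uniqueₑ R
    R! = subst Uniqueₑ (≡.sym (concatMap-pure rs)) (proj₁ (proj₂ (AllPairs-++⁻ P parts!)))
    unique : ∀ {x y} → (x , y) ∈ₑ P ⊎ (x , y) ∈ₑ rs → ∃! _≡_ λ i → Part i x y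
    unique (inj₁ e∈P) =
      let i , e∈i = ∈-block⁻ pathEdges ps e∈P
      in inj₁ i , ∈ₑ⇒edgeSet Γ (lookup ps i) (p⊆Γ i) e∈i , λ
        { {inj₁ j} e∈j → cong inj₁ (block-unique pathEdges ps P! i j e∈i (edgeSet⇒∈ₑ Γ (lookup ps j) (p⊆Γ j) e∈j))
        ; {inj₂ j} e∈j → ⊥-elim (disjoint P parts! e∈P (edge∈rs j e∈j)) }
    unique (inj₂ e∈rs) =
      inj₂ (Any.index e∈rs) , Any.lookup-index e∈rs , λ
        { {inj₁ j} e∈j → ⊥-elim (disjoint P parts! (∈-block⁺ pathEdges ps j (edgeSet⇒∈ₑ Γ (lookup ps j) (p⊆Γ j) e∈j)) e∈rs)
        ; {inj₂ j} e≈j → cong inj₂ (block-unique (_∷ []) rs R! (Any.index e∈rs) j (here (Any.lookup-index e∈rs)) (here e≈j)) }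

  withoutRemainder : P₄-DecompositionWithRemainder Γ 0 → P₄-Decomposition Γ
  withoutRemainder D = record
    { k         = m
    ; paths     = paths
    ; isP₄      = isP₄
    ; partition = record
      { nonempty = nonempty ∘ inj₁
      ; included = included ∘ inj₁
      ; unique   = λ xy → case unique xy of λ { (inj₁ i , e∈i , only) → i , e∈i , λ {j} e∈j → inj₁-injective (only {inj₁ j} e∈j) }
      }
    }
    where
    open P₄-DecompositionWithRemainder D renaming (k to m)
    open PartitionsEdges partition

  -- Tracing each subgraph along its isomorphism turns the decomposition into a near decomposition
  -- with nothing remaining, to which `remainder` applies.
  decomposable⇒∣E∣%3≡0 : P₄-Decomposition Γ → ∣E∣ Γ % 3 ≡ 0
  decomposable⇒∣E∣%3≡0 D = remainder (near
    (All.map⁺ (All.universal p! (allFin m))) z≤n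
    (subst (edges Γ ↭_) (≡.sym (≡.trans (++-identityʳ _) (concatMap-map pathEdges p (allFin m)))) edges↭))
    where
    open P₄-Decomposition D renaming (k to m)
    open PartitionsEdges partition
    module P i = Inverse (_≅_.bijection (isP₄ i))
    f : Fin m → Fin 4 → Fin n
    f i = proj₁ ∘ P.to i
    p : Fin m → Path n
    p i = trace (f i)
    p! : ∀ i → Distinct (p i)
    p! i = Unique.map⁺ (λ eq → Injection.injective (Inverse⇒Injection (_≅_.bijection (isP₄ i))) (vertices-≡ eq)) (Unique.allFin⁺ 4)
    part⇒∈ₑ : ∀ i {x y} → edgeSet (paths i) x y → (x , y) ∈ₑ pathEdges (p i)
    part⇒∈ₑ i {x} {y} (x∈ , y∈ , xy) =
      subst₂ (λ x y → (x , y) ∈ₑ pathEdges (p i)) (cong proj₁ (P.strictlyInverseˡ i _)) (cong proj₁ (P.strictlyInverseˡ i _))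
        (trace-adjacent (f i) (Equivalence.from (_≅_.adjacency (isP₄ i) (P.from i (x , x∈)) (P.from i (y , y∈)))
          (subst₂ (Adj (Subgraph.graph (paths i))) (≡.sym (P.strictlyInverseˡ i _)) (≡.sym (P.strictlyInverseˡ i _)) xy)))
    ∈ₑ⇒part : ∀ i {x y} → (x , y) ∈ₑ pathEdges (p i) → edgeSet (paths i) x y
    ∈ₑ⇒part i e∈ with a , b , ab , refl , refl ← trace-adjacent⁻ (f i) e∈ =
      _ , _ , Equivalence.to (_≅_.adjacency (isP₄ i) a b) ab
    L : List (Edge n)
    L = concatMap (pathEdges ∘ p) (allFin m)
    ∈L⁺ : ∀ {x y} i → edgeSet (paths i) x y → (x , y) ∈ₑ L
    ∈L⁺ i xy = MembershipSetoidProperties.∈-concatMap⁺ (≡.setoid _) (edgeSetoid n) (lose (∈-allFin i) (part⇒∈ₑ i xy))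
    ∈L⁻ : ∀ {x y} → (x , y) ∈ₑ L → ∃ λ i → edgeSet (paths i) x y
    ∈L⁻ e∈ = let i , _ , e∈i = find (MembershipSetoidProperties.∈-concatMap⁻ (≡.setoid _) (edgeSetoid n) {xs = allFin m} e∈)
             in i , ∈ₑ⇒part i e∈i
    part-unique : ∀ {x y i j} → edgeSet (paths i) x y → edgeSet (paths j) x y → i ≡ j
    part-unique {i = i} xyᵢ xyⱼ =
      let _ , _ , only = unique (included i xyᵢ) in ≡.trans (≡.sym (only xyᵢ)) (only xyⱼ)
    -- Blocks of different indices share no edge, since an edge lies in only one part.
    L! : Uniqueₑ L
    L! = AllPairs.concat⁺ (All.map⁺ (All.universal (λ i → pathEdges-unique (p i) (p! i)) (allFin m)))
      (AllPairs.map⁺ (AllPairs.map (λ {i} {j} i≢j → All.tabulate λ e∈i → All.tabulate λ e∈j e≈ →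
        i≢j (part-unique (∈ₑ⇒part i (lose e∈i (inj₁ (refl , refl)))) (∈ₑ⇒part j (lose e∈j e≈))))
        (Unique.allFin⁺ m)))
    edges↭ : edges Γ ↭ L
    edges↭ = UniqueLists.sameElements⇒↭ (edgeSetoid n) L! (edges-unique Γ)
      (λ e∈ → let i , xy = ∈L⁻ e∈ in adj⇒∈ₑ Γ (included i xy))
      (λ e∈ → let i , xy , _ = unique (∈ₑ⇒adj Γ e∈) in ∈L⁺ i xy)

theorem2p2 : ∀ (n : ℕ) (Γ : Graph (Fin n)) → n ≢ 3 → AtLeastTwoUniversalVertices Γ →
    (P₄-Decomposition Γ ⇔ ∣E∣ Γ % 3 ≡ 0)
    × (∣E∣ Γ % 3 ≡ 1 → P₄-DecompositionWithRemainder Γ 1)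
    × (∣E∣ Γ % 3 ≡ 2 → P₄-DecompositionWithRemainder Γ 2)
theorem2p2 n Γ n≢3 (u , v , u≢v , deg-u , deg-v) =
  mk⇔ (decomposable⇒∣E∣%3≡0 Γ) (withoutRemainder Γ ∘ decompose) , decompose , decompose
  where
  N : NearDecomposition (edges Γ)
  N = nearDecomposition Γ u≢v (degree≡n-1⇒universal Γ u deg-u) (degree≡n-1⇒universal Γ v deg-v) n≢3
  decompose : ∀ {r} → ∣E∣ Γ % 3 ≡ r → P₄-DecompositionWithRemainder Γ r
  -- The number of edges left over by `N` is already the residue modulo 3, so the same `N` serves
  -- for every `r`.
  decompose eq = subst (P₄-DecompositionWithRemainder Γ) (≡.trans (≡.sym (remainder Γ N)) eq) (withRemainder Γ N)
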